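{- Let $a,b\ge 1$ be integers and consider the altered Wythoff game with $\mathcal{N}=\emptyset$ and $\mathcal{P}=\{0,1,\dots,a-1\}\times\{0,1,\dots,b-1\}$. Let $A$ be its set of P-positions and $B$ the set of P-positions of the unaltered Wythoff game. Then $A_{(b-1,a-1)}$ is asymptotically equal to $B$.
   Context: Wythoff's game: a position is a pair $(x,y)$ of non-negative integers. A move from $(x,y)$ goes to $(x-k,y)$, $(x,y-k)$ or $(x-k,y-k)$ for some integer $k\ge1$, provided the resulting coordinates are non-negative. An altered Wythoff game is given by finite disjoint sets $\mathcal{P},\mathcal{N}\subset\mathbb{Z}_{\ge0}^2$; positions are labelled by recursion on $x+y$: positions in $\mathcal{P}$ are P, positions in $\mathcal{N}$ are N, and any other position is P if no position reachable from it in one move is labelled P, and N otherwise. The set of P-positions is the set of positions labelled P. The unaltered game is $\mathcal{P}=\mathcal{N}=\emptyset$; its P-positions are $B=\{(\lfloor\phi n\rfloor,\lfloor\phi^2 n\rfloor):n\ge0\}\cup\{(\lfloor\phi^2 n\rfloor,\lfloor\phi n\rfloor):n\ge0\}$, $\phi=(1+\sqrt5)/2$. For $S\subseteq\mathbb{Z}^2$, $S_{(\Delta x,\Delta y)}=\{(x+\Delta x,y+\Delta y):(x,y)\in S\}$. With $B_n=\{(x,y)\in\mathbb{Z}^2:x^2+y^2\le n^2\}$, infinite sets $S,T\subseteq\mathbb{Z}^2$ are asymptotically equal if $\lim_{n\to\infty}|(S\cap T)\cap B_n|/|(S\cup T)\cap B_n|=1$. -}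

module Defs where

open import Data.Nat using (ℕ; zero; suc; _+_; _*_; _∸_; _≤ᵇ_; _<ᵇ_)
open import Data.Bool using (Bool; true; false; if_then_else_; _∧_; _∨_; not)
open import Data.List using (List; map; upTo)
open import Data.Bool.ListAction using (any)
open import Data.Nat.ListAction using (sum)
open import Data.Integer using (+_)
open import Data.Rational using (ℚ; _/_; 1ℚ; _-_; ∣_∣; _<_)

PosSet : Set
PosSet = ℕ → ℕ → Bool

minℕ : ℕ → ℕ → ℕ
minℕ zero _ = zero
minℕ (suc _) zero = zero
minℕ (suc m) (suc n) = suc (minℕ m n)

someMove : PosSet → ℕ → ℕ → Bool
someMove f x y =
  any (λ k → f (x ∸ k) y) (map suc (upTo x)) ∨
  (any (λ k → f x (y ∸ k)) (map suc (upTo y)) ∨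
   any (λ k → f (x ∸ k) (y ∸ k)) (map suc (upTo (minℕ x y))))

-- Labelling of the altered Wythoff game with forced sets 𝒫 (forcedP) and
-- 𝒩 (forcedN); true = P, false = N.  The fuel argument implements the
-- recursion on x + y (fuel > x + y suffices, see isP).
labelFuel : PosSet → PosSet → ℕ → ℕ → ℕ → Bool
labelFuel fP fN zero x y = false
labelFuel fP fN (suc fuel) x y =
  if fP x y then true
  else if fN x y then false
  else not (someMove (labelFuel fP fN fuel) x y)

isP : PosSet → PosSet → PosSet
isP fP fN x y = labelFuel fP fN (suc (x + y)) x y

emptySet : PosSet
emptySet _ _ = false

rect : ℕ → ℕ → PosSet
rect a b x y = (x <ᵇ a) ∧ (y <ᵇ b)

Aset : ℕ → ℕ → PosSet
Aset a b = isP (rect a b) emptySet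

Bset : PosSet
Bset = isP emptySet emptySet

-- S_(Δx,Δy) for Δx, Δy ≥ 0, restricted to ℕ² (it contains no other points).
shift : ℕ → ℕ → PosSet → PosSet
shift dx dy S u v = (dx ≤ᵇ u) ∧ ((dy ≤ᵇ v) ∧ S (u ∸ dx) (v ∸ dy))

countDisc : PosSet → ℕ → ℕ
countDisc S n =
  sum (map (λ u → sum (map (λ v →
         if ((u * u + v * v) ≤ᵇ (n * n)) ∧ S u v then 1 else 0)
       (upTo (suc n)))) (upTo (suc n)))

_∩ₛ_ : PosSet → PosSet → PosSet
(S ∩ₛ T) x y = S x y ∧ T x y

_∪ₛ_ : PosSet → PosSet → PosSet
(S ∪ₛ T) x y = S x y ∨ T x y

ratio : PosSet → PosSet → ℕ → ℚ
ratio S T n with countDisc (S ∪ₛ T) n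
... | zero = 1ℚ
... | suc m = (+ countDisc (S ∩ₛ T) n) / suc m

AsymptoticallyEqual : PosSet → PosSet → Set
AsymptoticallyEqual S T =
  ∀ (ε : ℚ) → Data.Rational.0ℚ < ε →
    Σ ℕ (λ N → ∀ n → N Data.Nat.≤ n → ∣ ratio S T n - 1ℚ ∣ < ε)
  where open import Data.Product using (Σ)

{-# OPTIONS --safe #-}

-- Translate the altered game by (b ∸ 1, a ∸ 1) and put c = a + b ∸ 1.  Outside the forced
-- rectangle its P-positions are (t, t + X t) for the t ≥ c at which X rises and (t + Y t, t) for
-- those at which Y rises, where X t ∸ a and Y t ∸ b count the earlier rises.  That rows and columns
-- are shared out between the two families says that X and Y are, beyond c, the rounded inverses of
-- s ↦ s + Y s and s ↦ s + X s.  The unaltered game is the case a = b = 1, with X = Y = Z.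
-- The area between two increasing functions is the area between their inverses, so up to a
-- constant the sum of ∣ X − Z ∣ up to t is at most the sum of ∣ Y − Z ∣ up to about 2t/3, and
-- vice versa.  Hence both sums are o(t), and so is the number of P-positions that disagree,
-- whereas the number of P-positions in a disc grows linearly.
module Submission where

open import Defs
open import Data.Bool using (Bool; true; false; not; T; _∧_; _∨_; if_then_else_)
open import Data.Bool.ListAction using (any)
open import Data.Bool.Properties using (T-≡; T-∧; T-∨)
open import Data.Empty using (⊥; ⊥-elim)
open import Data.Integer as ℤ using (-[1+_]; +[1+_]; +<+)
import Data.Integer.Properties as ℤ
open import Data.List using (map; upTo; []; _∷_; _++_)
open import Data.List.Membership.Propositional using (find; lose)
open import Data.List.Membership.Propositional.Properties using (∈-map⁺; ∈-map⁻; ∈-upTo⁺; ∈-upTo⁻)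
open import Data.List.Properties using (upTo-∷ʳ; map-++)
open import Data.List.Relation.Unary.Any.Properties using (any⁺; any⁻)
open import Data.Nat
open import Data.Nat.DivMod using (m≡m%n+[m/n]*n; m%n<n)
open import Data.Nat.Induction using (<-rec)
open import Data.Nat.ListAction using (sum)
open import Data.Nat.ListAction.Properties using (sum-++)
open import Data.Nat.Properties
open import Data.Nat.Tactic.RingSolver using (solve-∀)
open import Data.Product using (∃; ∃₂; _×_; _,_; proj₁; proj₂)
open import Data.Rational as ℚ using (mkℚ; 0ℚ; 1ℚ; toℚᵘ; *<*)
import Data.Rational.Properties as ℚ
open import Data.Rational.Unnormalised as ℚᵘ using (mkℚᵘ; 1ℚᵘ)
import Data.Rational.Unnormalised.Properties as ℚᵘ
open import Data.Sum using (_⊎_; inj₁; inj₂; [_,_]′)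
open import Data.Unit using (tt)
open import Function.Bundles using (Equivalence; _⇔_; mk⇔)
open import Relation.Binary.Definitions using (tri<; tri≈; tri>)
open import Relation.Binary.PropositionalEquality
open import Relation.Nullary using (¬_; yes; no)

-- Interlaced counting functions

-- The linear-arithmetic step: a surplus r witnesses that x ≤ y is the hypothesis l ≤ u up to a common summand.
from-≤ : ∀ r {x y l u} → l ≤ u → x + u + r ≡ y + l → x ≤ y
from-≤ r {x} {y} {l} {u} l≤u eq = +-cancelʳ-≤ u x y (begin
  x + u      ≤⟨ m≤m+n (x + u) r ⟩
  x + u + r  ≡⟨ eq ⟩
  y + l      ≤⟨ +-monoʳ-≤ y l≤u ⟩
  y + u      ∎)
  where open ≤-Reasoning

-- The rules for `X` compare t + 1 with the value of s ↦ s + Y s at s = X t, and those for `Y` do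
-- the same with the roles exchanged. They are kept local so that a recursion can satisfy them by
-- definition; that `X` and `Y` are rounded inverses is derived from them.
record Interlaced (c a b : ℕ) (X Y : ℕ → ℕ) : Set where
  field
    a≥1     : 1 ≤ a
    b≥1     : 1 ≤ b
    a+b     : a + b ≡ suc c
    X-init  : ∀ {t} → t ≤ c → X t ≡ a
    Y-init  : ∀ {t} → t ≤ c → Y t ≡ b
    X-move  : ∀ {t} → c ≤ t → X t + Y (X t) ≤ suc t → X (suc t) ≡ suc (X t)
    X-stay  : ∀ {t} → c ≤ t → suc t < X t + Y (X t) → X (suc t) ≡ X t
    Y-move  : ∀ {t} → c ≤ t → Y t + X (Y t) ≤ suc t → Y (suc t) ≡ suc (Y t)
    Y-stay  : ∀ {t} → c ≤ t → suc t < Y t + X (Y t) → Y (suc t) ≡ Y t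

open Interlaced

swap : ∀ {c a b X Y} → Interlaced c a b X Y → Interlaced c b a Y X
swap {a = a} {b} I = record
  { a≥1 = b≥1 I ; b≥1 = a≥1 I ; a+b = trans (+-comm b a) (a+b I)
  ; X-init = Y-init I ; Y-init = X-init I
  ; X-move = Y-move I ; X-stay = Y-stay I ; Y-move = X-move I ; Y-stay = X-stay I }

module _ {c a b X Y} (I : Interlaced c a b X Y) where

  a≤c : a ≤ c
  a≤c = ≤-pred (≤-trans (+-monoˡ-≤ a (b≥1 I)) (≤-reflexive (trans (+-comm b a) (a+b I))))

  c≥1 : 1 ≤ c
  c≥1 = ≤-trans (a≥1 I) a≤c

  X-step : ∀ t → X (suc t) ≡ X t ⊎ X (suc t) ≡ suc (X t)
  X-step t with suc t ≤? c
  ... | yes t<c = inj₁ (trans (X-init I t<c) (sym (X-init I (<⇒≤ t<c))))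
  ... | no t≮c with X t + Y (X t) ≤? suc t
  ...   | yes p = inj₂ (X-move I (≤-pred (≰⇒> t≮c)) p)
  ...   | no ¬p = inj₁ (X-stay I (≤-pred (≰⇒> t≮c)) (≰⇒> ¬p))

  X-suc-≤ : ∀ t → X (suc t) ≤ suc (X t)
  X-suc-≤ t with X-step t
  ... | inj₁ e = ≤-trans (≤-reflexive e) (n≤1+n _)
  ... | inj₂ e = ≤-reflexive e

  X-≤-suc : ∀ t → X t ≤ X (suc t)
  X-≤-suc t with X-step t
  ... | inj₁ e = ≤-reflexive (sym e)
  ... | inj₂ e = ≤-trans (n≤1+n _) (≤-reflexive (sym e))

  X-mono : ∀ {s t} → s ≤ t → X s ≤ X t
  X-mono s≤t = go (≤⇒≤′ s≤t)
    where
    go : ∀ {s t} → s ≤′ t → X s ≤ X t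
    go ≤′-refl     = ≤-refl
    go (≤′-step p) = ≤-trans (go p) (X-≤-suc _)

  X-≤-a+ : ∀ t → X t ≤ t + a
  X-≤-a+ zero    = ≤-reflexive (X-init I z≤n)
  X-≤-a+ (suc t) = ≤-trans (X-suc-≤ t) (s≤s (X-≤-a+ t))

  a≤X : ∀ t → a ≤ X t
  a≤X t = ≤-trans (≤-reflexive (sym (X-init I z≤n))) (X-mono z≤n)

  rises⇒c≤ : ∀ {t} → X (suc t) ≡ suc (X t) → c ≤ t
  rises⇒c≤ {t} up with suc t ≤? c
  ... | no t≮c  = ≤-pred (≰⇒> t≮c)
  ... | yes t<c = ⊥-elim (1+n≢n (trans (sym up)
                    (trans (X-init I t<c) (sym (X-init I (<⇒≤ t<c))))))

shift-mono-< : ∀ {c a b X Y} → Interlaced c a b X Y → ∀ {s t} → s < t → s + X s < t + X t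
shift-mono-< I s<t = +-mono-<-≤ s<t (X-mono I (<⇒≤ s<t))

shift-suc-≤ : ∀ {c a b X Y} → Interlaced c a b X Y → ∀ s → suc s + X (suc s) ≤ 2 + (s + X s)
shift-suc-≤ {X = X} I s = ≤-trans (s≤s (+-monoʳ-≤ s (X-suc-≤ I s))) (≤-reflexive (cong suc (+-suc s (X s))))

module _ {c a b X Y} (I : Interlaced c a b X Y) where

  private
    -- Induction on t = n + c of the invariant that `X t` is the least s with s + Y s > t. It holds
    -- at t = c because `Y` equals b on [0, c], a ≤ c and a + b = c + 1.
    frontier : ∀ n → (∀ {s} → s < X (n + c) → s + Y s ≤ n + c) × n + c < X (n + c) + Y (X (n + c))
    frontier zero = below , ≤-reflexive (sym (trans (cong₂ _+_ Xc (trans (cong Y Xc) (Y-init I (a≤c I)))) (a+b I)))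
      where
      Xc = X-init I {c} ≤-refl
      below : ∀ {s} → s < X c → s + Y s ≤ c
      below {s} s<X = ≤-pred (begin
        suc s + Y s ≡⟨ cong (suc s +_) (Y-init I (≤-trans (<⇒≤ s<a) (a≤c I))) ⟩
        suc s + b   ≤⟨ +-monoˡ-≤ b s<a ⟩
        a + b       ≡⟨ a+b I ⟩
        suc c       ∎)
        where
        open ≤-Reasoning
        s<a = subst (s <_) Xc s<X
    frontier (suc n) with frontier n | X (n + c) + Y (X (n + c)) ≤? suc (n + c)
    ... | below , above | yes p
      rewrite X-move I (m≤n+m c n) p = below′ , s≤s (<-≤-trans above (+-monoʳ-≤ (X (n + c)) (X-≤-suc (swap I) (X (n + c)))))
      where
      below′ : ∀ {s} → s < suc (X (n + c)) → s + Y s ≤ suc (n + c)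
      below′ s<1+X with m≤n⇒m<n∨m≡n (≤-pred s<1+X)
      ... | inj₁ s<X  = m≤n⇒m≤1+n (below s<X)
      ... | inj₂ refl = p
    ... | below , above | no ¬p
      rewrite X-stay I (m≤n+m c n) (≰⇒> ¬p) = (λ s<X → m≤n⇒m≤1+n (below s<X)) , ≰⇒> ¬p

    frontier′ : ∀ {t} → c ≤ t → (∀ {s} → s < X t → s + Y s ≤ t) × t < X t + Y (X t)
    frontier′ {t} c≤t = subst (λ t → (∀ {s} → s < X t → s + Y s ≤ t) × t < X t + Y (X t)) (m∸n+n≡m c≤t) (frontier (t ∸ c))

  <X⇒shift-≤ : ∀ {s t} → c ≤ t → s < X t → s + Y s ≤ t
  <X⇒shift-≤ c≤t = proj₁ (frontier′ c≤t)

  shift-≤⇒<X : ∀ {s t} → c ≤ t → s + Y s ≤ t → s < X t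
  shift-≤⇒<X {s} {t} c≤t p with s <? X t
  ... | yes q = q
  ... | no ¬q = ⊥-elim (<⇒≱ (proj₂ (frontier′ c≤t))
                  (≤-trans (+-mono-≤ (≮⇒≥ ¬q) (X-mono (swap I) (≮⇒≥ ¬q))) p))

  -- Successive values of s ↦ s + Y s differ by 1 or 2, and `X` stays at t when t + 1 is skipped.
  -- Then t is itself a value, taken at the last s counted by `X t`, and the jump over t + 1 forces
  -- `Y` to rise at s. So a column without an upper P-position holds a lower one.
  stays⇒covered : ∀ {t} → c ≤ t → X (suc t) ≡ X t →
                  ∃ λ s → c ≤ s × Y (suc s) ≡ suc (Y s) × t ≡ s + Y s
  stays⇒covered {t} c≤t e = go (X t) refl
    where
    go : ∀ x → X t ≡ x → ∃ λ s → c ≤ s × Y (suc s) ≡ suc (Y s) × t ≡ s + Y s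
    go zero Xt = ⊥-elim (<⇒≱ (a≥1 I) (≤-trans (a≤X I t) (≤-reflexive Xt)))
    go (suc s) Xt = s , rises⇒c≤ (swap I) up , up , ≤-antisym t≤ g≤t
      where
      g≤t : s + Y s ≤ t
      g≤t = <X⇒shift-≤ c≤t (≤-reflexive (sym Xt))
      t< : suc t < suc s + Y (suc s)
      t< = ≰⇒> λ p → <⇒≱ (shift-≤⇒<X (m≤n⇒m≤1+n c≤t) p) (≤-reflexive (trans e Xt))
      up : Y (suc s) ≡ suc (Y s)
      up with X-step (swap I) s
      ... | inj₂ u = u
      ... | inj₁ u = ⊥-elim (<⇒≱ t< (≤-trans (≤-reflexive (cong (suc s +_) u)) (s≤s g≤t)))
      t≤ : t ≤ s + Y s
      t≤ = ≤-pred (≤-pred (≤-trans t< (shift-suc-≤ (swap I) s)))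

  -- If `Y` rises at s, the value after t = s + Y s is t + 2, whereas a rise of `X` at t would place
  -- the next value at t + 1. Hence no column holds both an upper and a lower P-position.
  rises⇒uncovered : ∀ {t s} → X (suc t) ≡ suc (X t) → Y (suc s) ≡ suc (Y s) → t ≢ s + Y s
  rises⇒uncovered {t} {s} up dn refl = <⇒≱ (≤-reflexive (cong suc (sym (+-suc s (Y s)))))
    (subst (_≤ suc t) (cong (suc s +_) dn)
      (<X⇒shift-≤ (m≤n⇒m≤1+n c≤t) (subst (suc s <_) (sym up) (s≤s (shift-≤⇒<X c≤t ≤-refl)))))
    where c≤t = rises⇒c≤ I up

  -- Discrete intermediate values: `X` climbs from a by steps of at most 1. This finds the upper
  -- P-position on a prescribed diagonal.
  rises-onto : ∀ {d} t → a ≤ d → d < X t → ∃ λ s → s < t × X (suc s) ≡ suc (X s) × X s ≡ d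
  rises-onto zero a≤d d<X = ⊥-elim (<⇒≱ d<X (≤-trans (≤-reflexive (X-init I z≤n)) a≤d))
  rises-onto {d} (suc t) a≤d d<X with d <? X t
  ... | yes p with rises-onto t a≤d p
  ...   | s , s<t , r = s , m<n⇒m<1+n s<t , r
  rises-onto {d} (suc t) a≤d d<X | no ¬p with X-step I t
  ... | inj₁ e = ⊥-elim (¬p (subst (d <_) e d<X))
  ... | inj₂ e = t , ≤-refl , e , ≤-antisym (≮⇒≥ ¬p) (≤-pred (subst (d <_) e d<X))

  -- Beyond c, s lies below X s + Y (X s), and Y n ≤ n + b, so `X` has slope at least one half. This
  -- yields both the upper slope 2/3 and the linear growth of the number of P-positions in a disc.
  <-2X : ∀ s → s < 2 * X s + (b + c)
  <-2X s with c ≤? s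
  ... | no c≰s  = <-≤-trans (≰⇒> c≰s) (≤-trans (m≤n+m c b) (m≤n+m (b + c) (2 * X s)))
  ... | yes c≤s = begin-strict
    s                     <⟨ ≰⇒> (λ p → <-irrefl refl (shift-≤⇒<X c≤s p)) ⟩
    X s + Y (X s)         ≤⟨ +-monoʳ-≤ (X s) (X-≤-a+ (swap I) (X s)) ⟩
    X s + (X s + b)       ≡⟨ lemma (X s) b ⟩
    2 * X s + b           ≤⟨ +-monoʳ-≤ (2 * X s) (m≤m+n b c) ⟩
    2 * X s + (b + c)     ∎
    where
    open ≤-Reasoning
    lemma : ∀ y b → y + (y + b) ≡ 2 * y + b
    lemma = solve-∀

-- The last s counted by `X t` satisfies s + Y s ≤ t, and Y s is at least about s / 2. The resulting
-- slope below 1 turns the comparison of areas into a contraction.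
3X-≤ : ∀ {c a b X Y} → Interlaced c a b X Y → ∀ t → 3 * X t ≤ 2 * t + (4 * a + c + 3)
3X-≤ {c} {a} {b} {X} {Y} I t with c ≤? t
... | no c≰t = begin
  3 * X t                     ≡⟨ cong (3 *_) (X-init I (<⇒≤ (≰⇒> c≰t))) ⟩
  3 * a                       ≤⟨ m≤m+n (3 * a) (2 * t + (a + c + 3)) ⟩
  3 * a + (2 * t + (a + c + 3)) ≡⟨ lemma a c t ⟩
  2 * t + (4 * a + c + 3)     ∎
  where
  open ≤-Reasoning
  lemma : ∀ a c t → 3 * a + (2 * t + (a + c + 3)) ≡ 2 * t + (4 * a + c + 3)
  lemma = solve-∀
... | yes c≤t = go (X t) refl
  where
  lemma : ∀ s y t a c → 3 * suc s + (2 * t + (2 * y + (a + c))) + (3 * a + 1)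
                      ≡ 2 * t + (4 * a + c + 3) + (2 * (s + y) + suc s)
  lemma = solve-∀
  go : ∀ x → X t ≡ x → 3 * x ≤ 2 * t + (4 * a + c + 3)
  go zero    _  = z≤n
  -- Twice s + Y s ≤ t is added to s < 2 * Y s + (a + c), which eliminates Y s.
  go (suc s) Xt = from-≤ (3 * a + 1)
    (+-mono-≤ (*-monoʳ-≤ 2 (<X⇒shift-≤ I c≤t (≤-reflexive (sym Xt)))) (<-2X (swap I) s))
    (lemma s (Y s) t a c)

-- The area between two interlaced systems

∑ : (ℕ → ℕ) → ℕ → ℕ
∑ f zero    = 0
∑ f (suc n) = ∑ f n + f n

∑-mono : ∀ {f g} n → (∀ {i} → i < n → f i ≤ g i) → ∑ f n ≤ ∑ g n
∑-mono zero    f≤g = z≤n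
∑-mono (suc n) f≤g = +-mono-≤ (∑-mono n (λ i<n → f≤g (m<n⇒m<1+n i<n))) (f≤g ≤-refl)

∑-extend : ∀ f {m n} → m ≤ n → ∑ f m ≤ ∑ f n
∑-extend f m≤n = go (≤⇒≤′ m≤n)
  where
  go : ∀ {m n} → m ≤′ n → ∑ f m ≤ ∑ f n
  go ≤′-refl     = ≤-refl
  go (≤′-step p) = ≤-trans (go p) (m≤m+n _ _)

∑-term : ∀ f {i n} → i < n → f i ≤ ∑ f n
∑-term f {i} i<n = ≤-trans (m≤n+m (f i) (∑ f i)) (∑-extend f i<n)

∑-+ : ∀ f g n → ∑ (λ i → f i + g i) n ≡ ∑ f n + ∑ g n
∑-+ f g zero    = refl
∑-+ f g (suc n) rewrite ∑-+ f g n = lemma (∑ f n) (∑ g n) (f n) (g n)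
  where
  lemma : ∀ a b c d → a + b + (c + d) ≡ a + c + (b + d)
  lemma = solve-∀

∑-*ˡ : ∀ k f n → ∑ (λ i → k * f i) n ≡ k * ∑ f n
∑-*ˡ k f zero    = sym (*-zeroʳ k)
∑-*ˡ k f (suc n) = trans (cong (_+ k * f n) (∑-*ˡ k f n)) (sym (*-distribˡ-+ k (∑ f n) (f n)))

∑-zero : ∀ n → ∑ (λ _ → 0) n ≡ 0
∑-zero zero    = refl
∑-zero (suc n) = trans (+-identityʳ _) (∑-zero n)

∑-swap : ∀ (f : ℕ → ℕ → ℕ) m n → ∑ (λ i → ∑ (f i) n) m ≡ ∑ (λ j → ∑ (λ i → f i j) m) n
∑-swap f zero    n = sym (∑-zero n)
∑-swap f (suc m) n = trans (cong (_+ ∑ (f m) n) (∑-swap f m n))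
                           (sym (∑-+ (λ j → ∑ (λ i → f i j) m) (f m) n))

∣+-+∣-≤ : ∀ a b c d → ∣ a + b - c + d ∣ ≤ ∣ a - c ∣ + ∣ b - d ∣
∣+-+∣-≤ a b c d = begin
  ∣ a + b - c + d ∣                      ≤⟨ ∣-∣-triangle (a + b) (c + b) (c + d) ⟩
  ∣ a + b - c + b ∣ + ∣ c + b - c + d ∣  ≡⟨ cong₂ _+_ (trans (cong₂ ∣_-_∣ (+-comm a b) (+-comm c b)) (∣m+n-m+o∣≡∣n-o∣ b a c)) (∣m+n-m+o∣≡∣n-o∣ c b d) ⟩
  ∣ a - c ∣ + ∣ b - d ∣                  ∎
  where open ≤-Reasoning

∣∑-∑∣-≤ : ∀ f g n → ∣ ∑ f n - ∑ g n ∣ ≤ ∑ (λ i → ∣ f i - g i ∣) n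
∣∑-∑∣-≤ f g zero    = z≤n
∣∑-∑∣-≤ f g (suc n) = ≤-trans (∣+-+∣-≤ (∑ f n) (f n) (∑ g n) (g n)) (+-monoˡ-≤ _ (∣∑-∑∣-≤ f g n))

𝟙 : Bool → ℕ
𝟙 b = if b then 1 else 0

𝟙-≤ : ∀ {m n} → m ≤ n → 𝟙 (m ≤ᵇ n) ≡ 1
𝟙-≤ m≤n = cong 𝟙 (Equivalence.to T-≡ (≤⇒≤ᵇ m≤n))

𝟙-> : ∀ {m n} → n < m → 𝟙 (m ≤ᵇ n) ≡ 0
𝟙-> {m} {n} n<m with m ≤ᵇ n in eq
... | false = refl
... | true  = ⊥-elim (<⇒≱ n<m (≤ᵇ⇒≤ m n (Equivalence.from T-≡ eq)))

∑-𝟙-≤ : ∀ g n → ∑ (λ t → 𝟙 (g ≤ᵇ t)) n ≡ n ∸ g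
∑-𝟙-≤ g zero = sym (0∸n≡0 g)
∑-𝟙-≤ g (suc n) with g ≤? n
... | yes g≤n = trans (cong₂ _+_ (∑-𝟙-≤ g n) (𝟙-≤ g≤n)) (trans (+-comm (n ∸ g) 1) (sym (+-∸-assoc 1 g≤n)))
... | no g≰n  = trans (cong₂ _+_ (∑-𝟙-≤ g n) (𝟙-> (≰⇒> g≰n)))
                  (trans (+-identityʳ _) (trans (m≤n⇒m∸n≡0 (<⇒≤ (≰⇒> g≰n))) (sym (m≤n⇒m∸n≡0 (≰⇒> g≰n)))))

-- The two indicators differ only for t between g and h. For g ≤ h, adding the indicator of h ≤ t to
-- their distance gives at most the indicator of g ≤ t, and both indicator sums are known.
∑-∣𝟙-𝟙∣-≤ : ∀ g h n → ∑ (λ t → ∣ 𝟙 (g ≤ᵇ t) - 𝟙 (h ≤ᵇ t) ∣) n ≤ ∣ g - h ∣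
∑-∣𝟙-𝟙∣-≤ g h n = [ ordered , reversed ]′ (≤-total g h)
  where
  open ≤-Reasoning
  d : ℕ → ℕ → ℕ → ℕ
  d g h t = ∣ 𝟙 (g ≤ᵇ t) - 𝟙 (h ≤ᵇ t) ∣
  ordered : ∀ {g h} → g ≤ h → ∑ (d g h) n ≤ ∣ g - h ∣
  ordered {g} {h} g≤h = +-cancelʳ-≤ (n ∸ h) _ _ (begin
    ∑ (d g h) n + (n ∸ h)                     ≡⟨ cong (∑ (d g h) n +_) (∑-𝟙-≤ h n) ⟨
    ∑ (d g h) n + ∑ (λ t → 𝟙 (h ≤ᵇ t)) n      ≡⟨ ∑-+ (d g h) (λ t → 𝟙 (h ≤ᵇ t)) n ⟨
    ∑ (λ t → d g h t + 𝟙 (h ≤ᵇ t)) n          ≤⟨ ∑-mono n (λ {t} _ → pointwise t) ⟩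
    ∑ (λ t → 𝟙 (g ≤ᵇ t)) n                    ≡⟨ ∑-𝟙-≤ g n ⟩
    n ∸ g                                     ≤⟨ ∸-monoˡ-≤ g (m≤n+m∸n n h) ⟩
    h + (n ∸ h) ∸ g                           ≡⟨ +-∸-comm (n ∸ h) g≤h ⟩
    h ∸ g + (n ∸ h)                           ≡⟨ cong (_+ (n ∸ h)) (sym (m≤n⇒∣m-n∣≡n∸m g≤h)) ⟩
    ∣ g - h ∣ + (n ∸ h)                       ∎)
    where
    pointwise : ∀ t → d g h t + 𝟙 (h ≤ᵇ t) ≤ 𝟙 (g ≤ᵇ t)
    pointwise t with h ≤? t
    ... | yes h≤t rewrite 𝟙-≤ h≤t | 𝟙-≤ (≤-trans g≤h h≤t) = ≤-refl
    ... | no h≰t  rewrite 𝟙-> (≰⇒> h≰t) = ≤-reflexive (trans (+-identityʳ _) (∣-∣-identityʳ _))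
  reversed : h ≤ g → ∑ (d g h) n ≤ ∣ g - h ∣
  reversed h≤g = begin
    ∑ (d g h) n  ≤⟨ ∑-mono n (λ {t} _ → ≤-reflexive (∣-∣-comm (𝟙 (g ≤ᵇ t)) (𝟙 (h ≤ᵇ t)))) ⟩
    ∑ (d h g) n  ≤⟨ ordered h≤g ⟩
    ∣ h - g ∣    ≡⟨ ∣-∣-comm h g ⟩
    ∣ g - h ∣    ∎

∑-initial : ∀ f m n → (∀ {i} → i < m → f i ≡ 1) → (∀ {i} → m ≤ i → f i ≡ 0) → m ≤ n → ∑ f n ≡ m
∑-initial f zero zero one nil m≤n = refl
∑-initial f m (suc n) one nil m≤n with m ≤? n
... | yes p = trans (cong₂ _+_ (∑-initial f m n one nil p) (nil p)) (+-identityʳ m)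
... | no ¬p with ≤-antisym m≤n (≰⇒> ¬p)
...   | refl = trans (cong₂ _+_ (ones n ≤-refl) (one ≤-refl)) (+-comm n 1)
  where
  ones : ∀ k → k ≤ n → ∑ f k ≡ k
  ones zero    _   = refl
  ones (suc k) k<n = trans (cong₂ _+_ (ones k (<⇒≤ k<n)) (one (m<n⇒m<1+n k<n))) (+-comm k 1)

-- The s with s + Y s ≤ t form the initial segment below `X t`. The range n is left free so that two
-- systems can be summed over the same range.
as-count : ∀ {c a b X Y} → Interlaced c a b X Y → ∀ {t n} → c ≤ t → X t ≤ n →
           X t ≡ ∑ (λ s → 𝟙 (s + Y s ≤ᵇ t)) n
as-count {X = X} I {t} {n} c≤t X≤n = sym (∑-initial _ (X t) n
  (λ i<X → 𝟙-≤ (<X⇒shift-≤ I c≤t i<X))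
  (λ X≤i → 𝟙-> (≰⇒> λ p → <⇒≱ (shift-≤⇒<X I c≤t p) X≤i)) X≤n)

-- X and X′ are the rounded inverses of s ↦ s + Y s and s ↦ s + Y′ s, so the graphs enclose the same area.
module _ {c a b X Y c′ a′ b′ X′ Y′} (I : Interlaced c a b X Y) (I′ : Interlaced c′ a′ b′ X′ Y′) where

  dist-≤ : ∀ {t n} → c ≤ t → c′ ≤ t → X t ≤ n → X′ t ≤ n →
           ∣ X t - X′ t ∣ ≤ ∑ (λ s → ∣ 𝟙 (s + Y s ≤ᵇ t) - 𝟙 (s + Y′ s ≤ᵇ t) ∣) n
  dist-≤ {t} {n} c≤t c′≤t X≤n X′≤n = ≤-trans
    (≤-reflexive (cong₂ ∣_-_∣ (as-count I c≤t X≤n) (as-count I′ c′≤t X′≤n)))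
    (∣∑-∑∣-≤ (λ s → 𝟙 (s + Y s ≤ᵇ t)) (λ s → 𝟙 (s + Y′ s ≤ᵇ t)) n)

  area-≤ : ∀ {n t} → X t ≤ n → X′ t ≤ n →
           ∑ (λ t → ∣ X t - X′ t ∣) t ≤ ∑ (λ t → ∣ X t - X′ t ∣) (c ⊔ c′) + ∑ (λ s → ∣ Y s - Y′ s ∣) n
  area-≤ {n} {t} X≤n X′≤n = begin
    ∑ d t                                              ≤⟨ split t X≤n X′≤n ⟩
    ∑ d (c ⊔ c′) + ∑ (λ t → ∑ (λ s → e s t) n) t       ≡⟨ cong (∑ d (c ⊔ c′) +_) (∑-swap (λ t s → e s t) t n) ⟩
    -- After the interchange, s contributes the number of t that separate s + Y s from s + Y′ s.
    ∑ d (c ⊔ c′) + ∑ (λ s → ∑ (e s) t) n               ≤⟨ +-monoʳ-≤ (∑ d (c ⊔ c′)) (∑-mono n (λ {s} _ → ≤-trans (∑-∣𝟙-𝟙∣-≤ (s + Y s) (s + Y′ s) t) (≤-reflexive (∣m+n-m+o∣≡∣n-o∣ s (Y s) (Y′ s))))) ⟩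
    ∑ d (c ⊔ c′) + ∑ (λ s → ∣ Y s - Y′ s ∣) n          ∎
    where
    open ≤-Reasoning
    d : ℕ → ℕ
    d t = ∣ X t - X′ t ∣
    e : ℕ → ℕ → ℕ
    e s t = ∣ 𝟙 (s + Y s ≤ᵇ t) - 𝟙 (s + Y′ s ≤ᵇ t) ∣
    split : ∀ t → X t ≤ n → X′ t ≤ n → ∑ d t ≤ ∑ d (c ⊔ c′) + ∑ (λ t → ∑ (λ s → e s t) n) t
    split zero    _   _    = z≤n
    split (suc t) X≤n X′≤n with c ⊔ c′ ≤? t
    -- The counting formula for both systems starts at c ⊔ c′; the terms before that are kept as a
    -- constant.
    ... | no p  = ≤-trans (∑-extend d (≰⇒> p)) (m≤m+n _ _)
    ... | yes p = ≤-trans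
      (+-mono-≤ (split t (≤-trans (X-≤-suc I t) X≤n) (≤-trans (X-≤-suc I′ t) X′≤n))
                (dist-≤ (m⊔n≤o⇒m≤o c c′ p) (m⊔n≤o⇒n≤o c c′ p)
                        (≤-trans (X-≤-suc I t) X≤n) (≤-trans (X-≤-suc I′ t) X′≤n)))
      (≤-reflexive (+-assoc (∑ d (c ⊔ c′)) _ _))

-- Shrinking the argument by a factor of about 2/3 costs only the constant K₁. In the strong
-- induction the cost q * K₁ is paid by the decrease from t to m.
sublinear : ∀ (S : ℕ → ℕ) K₁ K₂ → (∀ {m n} → m ≤ n → S m ≤ S n) →
            (∀ t → ∃ λ m → 3 * m ≤ 2 * t + K₂ × S t ≤ K₁ + S m) →
            ∀ q → ∃ λ K → ∀ t → q * S t ≤ t + K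
sublinear S K₁ K₂ S-mono contract q = q * S t₀ , <-rec _ bound
  where
  -- For t > t₀ the bound 3 * m ≤ 2 * t + K₂ gives 3 * (m + q * K₁) ≤ 2 * t + t₀ < 3 * t.
  t₀ = K₂ + 3 * (q * K₁)
  bound : ∀ t → (∀ {s} → s < t → q * S s ≤ s + q * S t₀) → q * S t ≤ t + q * S t₀
  bound t rec with t ≤? t₀
  ... | yes t≤t₀ = ≤-trans (*-monoʳ-≤ q (S-mono t≤t₀)) (m≤n+m _ t)
  ... | no t≰t₀ with contract t
  ...   | m , 3m≤ , S≤ = begin
    q * S t                         ≤⟨ *-monoʳ-≤ q S≤ ⟩
    q * (K₁ + S m)                  ≡⟨ *-distribˡ-+ q K₁ (S m) ⟩
    q * K₁ + q * S m                ≤⟨ +-monoʳ-≤ (q * K₁) (rec (≤-trans (s≤s (m≤m+n m (q * K₁))) small)) ⟩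
    q * K₁ + (m + q * S t₀)         ≡⟨ lemma₁ (q * K₁) m (q * S t₀) ⟩
    (m + q * K₁) + q * S t₀         ≤⟨ +-monoˡ-≤ (q * S t₀) (<⇒≤ small) ⟩
    t + q * S t₀                    ∎
    where
    open ≤-Reasoning
    lemma₁ : ∀ x m y → x + (m + y) ≡ (m + x) + y
    lemma₁ = solve-∀
    lemma₂ : ∀ m x t k → suc (3 * (m + x)) + (2 * t + k + t) + 0 ≡ 3 * t + (3 * m + suc (k + 3 * x))
    lemma₂ = solve-∀
    small : m + q * K₁ < t
    small = *-cancelˡ-< 3 _ _ (from-≤ 0 (+-mono-≤ 3m≤ (≰⇒> t≰t₀)) (lemma₂ m (q * K₁) t K₂))

module _ {c a b X Y c′ a′ b′ X′ Y′} (I : Interlaced c a b X Y) (I′ : Interlaced c′ a′ b′ X′ Y′) where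

  -- The two areas are taken together because `area-≤` bounds each by the other at a smaller
  -- argument.
  discrepancy : ℕ → ℕ
  discrepancy t = ∑ (λ t → ∣ X t - X′ t ∣) t + ∑ (λ t → ∣ Y t - Y′ t ∣) t

  discrepancy-sublinear : ∀ q → ∃ λ K → ∀ t → q * discrepancy t ≤ t + K
  discrepancy-sublinear = sublinear discrepancy (discrepancy (c ⊔ c′)) κ
    (λ m≤n → +-mono-≤ (∑-extend _ m≤n) (∑-extend _ m≤n))
    (λ t → m t , 3m≤ t , contract t)
    where
    m : ℕ → ℕ
    -- The largest of the four values, so that one range serves both uses of `area-≤`.
    m t = (X t ⊔ X′ t) ⊔ (Y t ⊔ Y′ t)
    k = λ a c → 4 * a + c + 3
    κ = (k a c ⊔ k a′ c′) ⊔ (k b c ⊔ k b′ c′)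
    lub : ∀ n o {p} → 3 * n ≤ p → 3 * o ≤ p → 3 * (n ⊔ o) ≤ p
    lub n o 3n≤p 3o≤p = ≤-trans (≤-reflexive (*-distribˡ-⊔ 3 n o)) (⊔-lub 3n≤p 3o≤p)
    3m≤ : ∀ t → 3 * m t ≤ 2 * t + κ
    3m≤ t = lub (X t ⊔ X′ t) (Y t ⊔ Y′ t)
      (lub (X t) (X′ t) (≤-trans (3X-≤ I t) (+-monoʳ-≤ (2 * t) (≤-trans (m≤m⊔n (k a c) (k a′ c′)) (m≤m⊔n _ _))))
           (≤-trans (3X-≤ I′ t) (+-monoʳ-≤ (2 * t) (≤-trans (m≤n⊔m (k a c) (k a′ c′)) (m≤m⊔n _ _)))))
      (lub (Y t) (Y′ t) (≤-trans (3X-≤ (swap I) t) (+-monoʳ-≤ (2 * t) (≤-trans (m≤m⊔n (k b c) (k b′ c′)) (m≤n⊔m (k a c ⊔ k a′ c′) _))))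
           (≤-trans (3X-≤ (swap I′) t) (+-monoʳ-≤ (2 * t) (≤-trans (m≤n⊔m (k b c) (k b′ c′)) (m≤n⊔m (k a c ⊔ k a′ c′) _)))))
    contract : ∀ t → discrepancy t ≤ discrepancy (c ⊔ c′) + discrepancy (m t)
    contract t = ≤-trans
      (+-mono-≤ (area-≤ I I′ {m t} (≤-trans (m≤m⊔n (X t) _) (m≤m⊔n _ _)) (≤-trans (m≤n⊔m (X t) _) (m≤m⊔n _ _)))
                (area-≤ (swap I) (swap I′) {m t} (≤-trans (m≤m⊔n (Y t) _) (m≤n⊔m (X t ⊔ X′ t) _))
                        (≤-trans (m≤n⊔m (Y t) _) (m≤n⊔m (X t ⊔ X′ t) _))))
      (≤-reflexive (lemma (∑ dX (c ⊔ c′)) (∑ dY (m t)) (∑ dY (c ⊔ c′)) (∑ dX (m t))))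
      where
      dX dY : ℕ → ℕ
      dX t = ∣ X t - X′ t ∣
      dY t = ∣ Y t - Y′ t ∣
      lemma : ∀ p q r s → p + q + (r + s) ≡ p + r + (s + q)
      lemma = solve-∀

-- The P-positions of the altered game

-- The length k of the move is eliminated: a diagonal move lowers both coordinates and keeps their
-- difference. The additive form avoids truncated subtraction under transposition and translation.
data Move (x y : ℕ) : ℕ → ℕ → Set where
  horizontal : ∀ {x′} → x′ < x → Move x y x′ y
  vertical   : ∀ {y′} → y′ < y → Move x y x y′
  diagonal   : ∀ {x′ y′} → x′ < x → y′ < y → x′ + y ≡ x + y′ → Move x y x′ y′

Move-transpose : ∀ {x y x′ y′} → Move x y x′ y′ → Move y x y′ x′
Move-transpose (horizontal p) = vertical p
Move-transpose (vertical p)   = horizontal p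
Move-transpose {x} {y} {x′} {y′} (diagonal p q e) =
  diagonal q p (trans (+-comm y′ x) (trans (sym e) (+-comm x′ y)))

Move-decreases : ∀ {x y x′ y′} → Move x y x′ y′ → x′ + y′ < x + y
Move-decreases {y = y} (horizontal p) = +-monoˡ-< y p
Move-decreases {x = x} (vertical p)   = +-monoʳ-< x p
Move-decreases (diagonal p q _)       = +-mono-< p q

Move-shift : ∀ m n {x y x′ y′} → Move x y x′ y′ → Move (m + x) (n + y) (m + x′) (n + y′)
Move-shift m n (horizontal p) = horizontal (+-monoʳ-< m p)
Move-shift m n (vertical p)   = vertical (+-monoʳ-< n p)
Move-shift m n {x} {y} {x′} {y′} (diagonal p q e) = diagonal (+-monoʳ-< m p) (+-monoʳ-< n q)
  (trans (lemma m x′ n y) (trans (cong (m + n +_) e) (sym (lemma m x n y′))))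
  where
  lemma : ∀ m x n y → m + x + (n + y) ≡ m + n + (x + y)
  lemma = solve-∀

Move-unshift : ∀ m n {x y x′ y′} → Move (m + x) (n + y) (m + x′) (n + y′) → Move x y x′ y′
Move-unshift m n {x} {y} {x′} {y′} mv = go mv refl refl
  where
  go : ∀ {u v} → Move (m + x) (n + y) u v → u ≡ m + x′ → v ≡ n + y′ → Move x y x′ y′
  go (horizontal p) refl e with +-cancelˡ-≡ n y y′ e
  ... | refl = horizontal (+-cancelˡ-< m x′ x p)
  go (vertical p) e refl with +-cancelˡ-≡ m x x′ e
  ... | refl = vertical (+-cancelˡ-< n y′ y p)
  go (diagonal p q e) refl refl = diagonal (+-cancelˡ-< m x′ x p) (+-cancelˡ-< n y′ y q)
    (+-cancelˡ-≡ (m + n) (x′ + y) (x + y′) (trans (sym (lemma m x′ n y)) (trans e (lemma m x n y′))))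
    where
    lemma : ∀ m x n y → m + x + (n + y) ≡ m + n + (x + y)
    lemma = solve-∀

any-move⁺ : ∀ (p : ℕ → Bool) {i n} → i < n → T (p (suc i)) → T (any p (map suc (upTo n)))
any-move⁺ p i<n t = any⁺ p (lose (∈-map⁺ suc (∈-upTo⁺ i<n)) t)

any-move⁻ : ∀ (p : ℕ → Bool) n → T (any p (map suc (upTo n))) → ∃ λ i → i < n × T (p (suc i))
any-move⁻ p n t with find (any⁻ p (map suc (upTo n)) t)
... | k , k∈ , pk with ∈-map⁻ suc k∈
...   | i , i∈ , refl = i , ∈-upTo⁻ i∈ , pk

minℕ≡⊓ : ∀ m n → minℕ m n ≡ m ⊓ n
minℕ≡⊓ zero    n       = refl
minℕ≡⊓ (suc m) zero    = refl
minℕ≡⊓ (suc m) (suc n) = cong suc (minℕ≡⊓ m n)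

someMove⁺ : ∀ f {x y x′ y′} → Move x y x′ y′ → T (f x′ y′) → T (someMove f x y)
someMove⁺ f {y = y} (horizontal {x′} p) t with m≤n⇒∃[o]m+o≡n p
... | i , refl = Equivalence.from T-∨ (inj₁ (any-move⁺ (λ k → f (suc (x′ + i) ∸ k) y) (s≤s (m≤n+m i x′))
      (subst (λ x → T (f x y)) (sym (m+n∸n≡m x′ i)) t)))
someMove⁺ f {x} (vertical {y′} p) t with m≤n⇒∃[o]m+o≡n p
... | i , refl = Equivalence.from (T-∨ {any (λ k → f (x ∸ k) (suc (y′ + i))) (map suc (upTo x))})
      (inj₂ (Equivalence.from T-∨ (inj₁
      (any-move⁺ (λ k → f x (suc (y′ + i) ∸ k)) (s≤s (m≤n+m i y′))
        (subst (λ y → T (f x y)) (sym (m+n∸n≡m y′ i)) t)))))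
someMove⁺ f {x} {y} (diagonal {x′} {y′} p q e) t with m≤n⇒∃[o]m+o≡n p
... | i , refl with +-cancelˡ-≡ x′ y (suc i + y′) (trans e (lemma x′ i y′))
  where
  lemma : ∀ x i y → suc x + i + y ≡ x + (suc i + y)
  lemma = solve-∀
...   | refl = Equivalence.from (T-∨ {any (λ k → f (suc (x′ + i) ∸ k) y) (map suc (upTo (suc (x′ + i))))})
  (inj₂ (Equivalence.from (T-∨ {any (λ k → f x (y ∸ k)) (map suc (upTo y))}) (inj₂
      (any-move⁺ (λ k → f (suc (x′ + i) ∸ k) (suc (i + y′) ∸ k))
        (subst (i <_) (sym (minℕ≡⊓ (suc (x′ + i)) (suc (i + y′)))) (s≤s (⊓-glb (m≤n+m i x′) (m≤m+n i y′))))
        (subst₂ (λ x y → T (f x y)) (sym (m+n∸n≡m x′ i)) (sym (m+n∸m≡n i y′)) t)))))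

∸-suc-< : ∀ {i n} → i < n → n ∸ suc i < n
∸-suc-< {i} (s≤s {n = n} _) = s≤s (m∸n≤m n i)

someMove⁻ : ∀ f x y → T (someMove f x y) → ∃₂ λ x′ y′ → Move x y x′ y′ × T (f x′ y′)
someMove⁻ f x y t with Equivalence.to (T-∨ {any (λ k → f (x ∸ k) y) (map suc (upTo x))}) t
... | inj₁ h with any-move⁻ (λ k → f (x ∸ k) y) x h
...   | i , i<x , r = _ , _ , horizontal (∸-suc-< i<x) , r
someMove⁻ f x y t | inj₂ t′ with Equivalence.to (T-∨ {any (λ k → f x (y ∸ k)) (map suc (upTo y))}) t′
... | inj₁ v with any-move⁻ (λ k → f x (y ∸ k)) y v
...   | i , i<y , r = _ , _ , vertical (∸-suc-< i<y) , r
someMove⁻ f x y t | inj₂ t′ | inj₂ d with any-move⁻ (λ k → f (x ∸ k) (y ∸ k)) (minℕ x y) d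
... | i , i<m , r = _ , _ , diagonal (∸-suc-< i<x) (∸-suc-< i<y)
                      (trans (sym (+-∸-comm y i<x)) (+-∸-assoc x i<y)) , r
  where
  i<x : i < x
  i<x = m<n⊓o⇒m<n x y (subst (i <_) (minℕ≡⊓ x y) i<m)
  i<y : i < y
  i<y = m<n⊓o⇒m<o x y (subst (i <_) (minℕ≡⊓ x y) i<m)

-- The kernel principle: the P-positions are characterised as a set that contains the forced ones,
-- has no internal move from an unforced member, and can be reached in one move from every
-- non-member. The two inclusions are proved together, since moves decrease x + y.
module _ {forced : PosSet} {Q : ℕ → ℕ → Set}
  (forced⊆Q : ∀ {x y} → T (forced x y) → Q x y)
  (stable   : ∀ {x y x′ y′} → ¬ T (forced x y) → Q x y → Move x y x′ y′ → ¬ Q x′ y′)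
  (absorb   : ∀ x y → Q x y ⊎ ∃₂ λ x′ y′ → Move x y x′ y′ × Q x′ y′)
  where

  mutual
    labelFuel-sound : ∀ fuel {x y} → x + y < fuel → T (labelFuel forced emptySet fuel x y) → Q x y
    labelFuel-sound (suc fuel) {x} {y} (s≤s x+y≤) t with forced x y in eq
    ... | true  = forced⊆Q (Equivalence.from T-≡ eq)
    ... | false with absorb x y
    ...   | inj₁ q = q
    ...   | inj₂ (x′ , y′ , mv , q) = ⊥-elim (not-both (someMove f x y) t
              (someMove⁺ f mv (labelFuel-complete fuel (<-≤-trans (Move-decreases mv) x+y≤) q)))
      where
      f = labelFuel forced emptySet fuel
      not-both : ∀ b → T (not b) → T b → ⊥
      not-both true  p _ = p
      not-both false _ p = p

    labelFuel-complete : ∀ fuel {x y} → x + y < fuel → Q x y → T (labelFuel forced emptySet fuel x y)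
    labelFuel-complete (suc fuel) {x} {y} (s≤s x+y≤) q with forced x y in eq
    ... | true  = tt
    ... | false = complement (someMove f x y) λ t →
                    let x′ , y′ , mv , t′ = someMove⁻ f x y t in
                    stable (λ t → subst T eq t) q mv
                      (labelFuel-sound fuel (<-≤-trans (Move-decreases mv) x+y≤) t′)
      where
      f = labelFuel forced emptySet fuel
      complement : ∀ b → ¬ T b → T (not b)
      complement true  ¬p = ⊥-elim (¬p tt)
      complement false _  = tt

  isP⇔ : ∀ {x y} → T (isP forced emptySet x y) ⇔ Q x y
  isP⇔ {x} {y} = mk⇔ (labelFuel-sound _ {x} {y} ≤-refl) (labelFuel-complete _ {x} {y} ≤-refl)

-- Coordinates are those of the shifted set, so the forced rectangle is [b ∸ 1, c) × [a ∸ 1, c).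
data Kernel (c a b : ℕ) (X Y : ℕ → ℕ) : ℕ → ℕ → Set where
  corner : ∀ {u v} → b ≤ suc u → u < c → a ≤ suc v → v < c → Kernel c a b X Y u v
  upper  : ∀ {u} → X (suc u) ≡ suc (X u) → Kernel c a b X Y u (u + X u)
  lower  : ∀ {v} → Y (suc v) ≡ suc (Y v) → Kernel c a b X Y (v + Y v) v

Kernel-transpose : ∀ {c a b X Y u v} → Kernel c a b X Y u v → Kernel c b a Y X v u
Kernel-transpose (corner p q r s) = corner r s p q
Kernel-transpose (upper p)        = lower p
Kernel-transpose (lower p)        = upper p

-- Two upper positions share no row, since u + X u is strictly increasing, and no diagonal, since
-- `X` has different values at two rises. Lower positions lie on the other side of the main diagonal
-- and in columns where `X` does not rise.
upper-stable : ∀ {c a b X Y} → Interlaced c a b X Y → ∀ {u u′ v′} →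
               X (suc u) ≡ suc (X u) → Move u (u + X u) u′ v′ → ¬ Kernel c a b X Y u′ v′
upper-stable {c} {a} {b} {X} {Y} I {u} up mv K = go mv K refl
  where
  c≤u = rises⇒c≤ I up
  go : ∀ {u′ v′ v} → Move u v u′ v′ → Kernel c a b X Y u′ v′ → v ≡ u + X u → ⊥
  go (horizontal p) (corner _ _ _ v<c) refl = <⇒≱ v<c (≤-trans c≤u (m≤m+n u (X u)))
  go (horizontal p) (upper {u′} up′) e = <-irrefl e (shift-mono-< I p)
  go (horizontal {x′} p) (lower {v} dn) refl =
    <⇒≱ p (≤-trans (m≤m+n u (X u)) (m≤m+n v (Y v)))
  go (vertical p) (corner _ u<c _ _) e = <⇒≱ u<c c≤u
  go (vertical p) (upper _) refl = <-irrefl refl p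
  go (vertical p) (lower dn) e = rises⇒uncovered I up dn refl
  -- The difference of coordinates is X u ≥ a on the left, but at most (c - 1) - (b - 1) = a - 1 in
  -- the corner.
  go (diagonal {u′} {v′} p q e) (corner b≤ u<c a≤ v<c) refl = <⇒≱ v<c (≤-pred (begin
    suc c             ≡⟨ a+b I ⟨
    a + b             ≤⟨ +-mono-≤ (a≤X I u) b≤ ⟩
    X u + suc u′      ≡⟨ +-suc (X u) u′ ⟩
    suc (X u + u′)    ≡⟨ cong suc (+-cancelˡ-≡ u _ _ (trans (lemma u (X u) u′) e)) ⟩
    suc v′            ∎))
    where
    open ≤-Reasoning
    lemma : ∀ u x u′ → u + (x + u′) ≡ u′ + (u + x)
    lemma = solve-∀
  go (diagonal {u′} p q e) (upper up′) refl = <-irrefl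
    (sym (+-cancelˡ-≡ (u + u′) _ _ (trans (lemma u u′ (X u)) (trans e (sym (+-assoc u u′ (X u′)))))))
    (≤-trans (≤-reflexive (sym up′)) (X-mono I p))
    where
    lemma : ∀ u u′ x → u + u′ + x ≡ u′ + (u + x)
    lemma = solve-∀
  go (diagonal {_} {v′} p q e) (lower dn) refl = <-irrefl (sym e) (begin-strict
    u + v′                <⟨ m<m+n (u + v′) (≤-trans (≤-trans (b≥1 I) (a≤X (swap I) v′)) (m≤m+n _ _)) ⟩
    u + v′ + (Y v′ + X u) ≡⟨ lemma v′ (Y v′) u (X u) ⟩
    v′ + Y v′ + (u + X u) ∎)
    where
    open ≤-Reasoning
    lemma : ∀ v y u x → u + v + (y + x) ≡ v + y + (u + x)
    lemma = solve-∀

Kernel-stable : ∀ {c a b X Y} → Interlaced c a b X Y → ∀ {u v u′ v′} → ¬ (u < c × v < c) →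
                Kernel c a b X Y u v → Move u v u′ v′ → ¬ Kernel c a b X Y u′ v′
Kernel-stable I outside (corner _ u<c _ v<c) mv K = outside (u<c , v<c)
Kernel-stable I outside (upper up) mv K = upper-stable I up mv K
Kernel-stable I outside (lower dn) mv K = upper-stable (swap I) dn (Move-transpose mv) (Kernel-transpose K)

Absorbs : (c a b : ℕ) (X Y : ℕ → ℕ) → ℕ → ℕ → Set
Absorbs c a b X Y u v = Kernel c a b X Y u v ⊎ ∃₂ λ u′ v′ → Move u v u′ v′ × Kernel c a b X Y u′ v′

Absorbs-transpose : ∀ {c a b X Y u v} → Absorbs c a b X Y u v → Absorbs c b a Y X v u
Absorbs-transpose (inj₁ K)                = inj₁ (Kernel-transpose K)
Absorbs-transpose (inj₂ (_ , _ , mv , K)) = inj₂ (_ , _ , Move-transpose mv , Kernel-transpose K)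

module _ {c a b X Y} (I : Interlaced c a b X Y) where

  -- Column u contains a P-position in either case. It is reached vertically unless it is an upper
  -- one above v; then a ≤ v - u < X u, and this difference was already used by an earlier rise,
  -- which is reached diagonally.
  absorb-upper : ∀ {u v} → c ≤ u → u + a ≤ v → Absorbs c a b X Y u v
  absorb-upper {u} {v} c≤u u+a≤v with X-step I u
  ... | inj₁ stay with stays⇒covered I c≤u stay
  ...   | s , _ , dn , refl = inj₂ (_ , _ , vertical (≤-<-trans (m≤m+n s (Y s)) (<-≤-trans (m<m+n _ (a≥1 I)) u+a≤v)) , lower dn)
  absorb-upper {u} {v} c≤u u+a≤v | inj₂ up with <-cmp v (u + X u)
  ... | tri≈ _ refl _ = inj₁ (upper up)
  ... | tri> _ _ v>   = inj₂ (_ , _ , vertical v> , upper up)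
  ... | tri< v< _ _ with m≤n⇒∃[o]m+o≡n (≤-trans (m≤m+n u a) u+a≤v)
  ...   | d , refl with rises-onto I u (+-cancelˡ-≤ u a d u+a≤v) (+-cancelˡ-< u d (X u) v<)
  ...     | s , s<u , up′ , refl = inj₂ (_ , _ , diagonal s<u (+-monoˡ-< (X s) s<u) (lemma s u (X s)) , upper up′)
    where
    lemma : ∀ s u d → s + (u + d) ≡ u + (s + d)
    lemma = solve-∀

  absorb-strip : ∀ {u v} → b ≤ suc u → u < c → c ≤ v → Absorbs c a b X Y u v
  absorb-strip {u} b≤ u<c c≤v with m≤n⇒∃[o]m+o≡n (c≥1 I)
  -- The target lies in the top row of the corner, k = c - 1.
  ... | k , refl = inj₂ (u , k , vertical c≤v , corner b≤ u<c (a≤c I) ≤-refl)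

  absorb-diagonal : ∀ {u v} → c ≤ u → u ≤ v → v < u + a → Absorbs c a b X Y u v
  absorb-diagonal {u} {v} c≤u u≤v v<u+a with m≤n⇒∃[o]m+o≡n u≤v
  ... | d , refl with m≤n⇒∃[o]m+o≡n (+-cancelˡ-< u d a v<u+a) | m≤n⇒∃[o]m+o≡n (a≤c I) | m≤n⇒∃[o]m+o≡n c≤u
  ...   | e , refl | f , refl | g , refl =
      -- With a = d + e + 1 and c = a + f the target is (c - 1 - d, c - 1), where the diagonal meets
      -- the top row of the corner. Its first coordinate is at least f = b - 1 because d < a.
      inj₂ (_ , _ , diagonal {x′ = e + f} {y′ = d + e + f}
              (s≤s (≤-trans (≤-trans (m≤n+m (e + f) d) (≤-reflexive (sym (+-assoc d e f)))) (m≤m+n _ g)))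
              (s≤s (≤-trans (m≤m+n (d + e + f) g) (m≤m+n _ d)))
              (lemma d e f g)
          , corner (≤-trans (≤-reflexive b≡) (s≤s (m≤n+m f e))) (s≤s (≤-trans (m≤n+m (e + f) d) (≤-reflexive (sym (+-assoc d e f)))))
                   (s≤s (m≤m+n (d + e) f)) ≤-refl)
    where
    lemma : ∀ d e f g → e + f + (suc (d + e) + f + g + d) ≡ suc (d + e) + f + g + (d + e + f)
    lemma = solve-∀
    b≡ : b ≡ suc f
    b≡ = +-cancelˡ-≡ (suc (d + e)) b (suc f) (trans (a+b I) (sym (+-suc (suc (d + e)) f)))

absorb : ∀ {c a b X Y} → Interlaced c a b X Y → ∀ {u v} → b ≤ suc u → a ≤ suc v → Absorbs c a b X Y u v
absorb {c} {a} {b} I {u} {v} b≤ a≤ with u <? c | v <? c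
... | yes u<c | yes v<c = inj₁ (corner b≤ u<c a≤ v<c)
... | yes u<c | no v≮c  = absorb-strip I b≤ u<c (≮⇒≥ v≮c)
... | no u≮c  | yes v<c = Absorbs-transpose (absorb-strip (swap I) a≤ v<c (≮⇒≥ u≮c))
... | no u≮c  | no v≮c with ≤-total u v
...   | inj₁ u≤v with u + a ≤? v
...     | yes p = absorb-upper I (≮⇒≥ u≮c) p
...     | no ¬p = absorb-diagonal I (≮⇒≥ u≮c) u≤v (≰⇒> ¬p)
absorb {c} {a} {b} I {u} {v} b≤ a≤ | no u≮c | no v≮c | inj₂ v≤u with v + b ≤? u
... | yes p = Absorbs-transpose (absorb-upper (swap I) (≮⇒≥ v≮c) p)
... | no ¬p = Absorbs-transpose (absorb-diagonal (swap I) (≮⇒≥ v≮c) v≤u (≰⇒> ¬p))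

-- Existence of the counting functions

if-≤ : ∀ {A : Set} {x y : A} {m n} → m ≤ n → (if m ≤ᵇ n then x else y) ≡ x
if-≤ {m = m} {n} m≤n rewrite Equivalence.to (T-≡ {m ≤ᵇ n}) (≤⇒≤ᵇ m≤n) = refl

if-> : ∀ {A : Set} {x y : A} {m n} → n < m → (if m ≤ᵇ n then x else y) ≡ y
if-> {m = m} {n} n<m with m ≤ᵇ n in eq
... | false = refl
... | true  = ⊥-elim (<⇒≱ n<m (≤ᵇ⇒≤ m n (Equivalence.from T-≡ eq)))

-- The recursion is nested; table c a b n is correct for arguments up to n + c.
table : (c a b n : ℕ) → ℕ → ℕ
table c a b zero    t = a
table c a b (suc n) t = if t ≤ᵇ n + c then table c a b n t else
  (let s = table c a b n (n + c) in if s + table c b a n s ≤ᵇ suc (n + c) then suc s else s)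

count : (c a b : ℕ) → ℕ → ℕ
count c a b t = table c a b t t

table-stable : ∀ c a b {m n t} → m ≤ n → t ≤ m + c → table c a b n t ≡ table c a b m t
table-stable c a b m≤n t≤ = go (≤⇒≤′ m≤n) t≤
  where
  go : ∀ {m n t} → m ≤′ n → t ≤ m + c → table c a b n t ≡ table c a b m t
  go ≤′-refl t≤ = refl
  go (≤′-step p) t≤ = trans (if-≤ (≤-trans t≤ (+-monoˡ-≤ c (≤′⇒≤ p)))) (go p t≤)

count≡table : ∀ c a b {n t} → t ≤ n + c → count c a b t ≡ table c a b n t
count≡table c a b {n} {t} t≤ with ≤-total n t
... | inj₁ n≤t = table-stable c a b n≤t t≤
... | inj₂ t≤n = sym (table-stable c a b t≤n (m≤m+n t c))

count-next : ∀ c a b n → let s = table c a b n (n + c) in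
             count c a b (suc (n + c)) ≡ (if s + table c b a n s ≤ᵇ suc (n + c) then suc s else s)
count-next c a b n = trans (count≡table c a b {suc n} ≤-refl) (if-> {m = suc (n + c)} {n + c} ≤-refl)

-- This keeps the inner argument of the nested recursion in the range where the other table is
-- already correct at the same level.
table-≤ : ∀ c a b → a ≤ c → ∀ n → table c a b n (n + c) ≤ n + c
table-≤ c a b a≤c zero    = a≤c
table-≤ c a b a≤c (suc n) = ≤-trans (≤-reflexive (if-> {m = suc n + c} {n + c} ≤-refl)) (bound (s + table c b a n s ≤ᵇ suc (n + c)))
  where
  s = table c a b n (n + c)
  bound : ∀ p → (if p then suc s else s) ≤ suc (n + c)
  bound true  = s≤s (table-≤ c a b a≤c n)
  bound false = m≤n⇒m≤1+n (table-≤ c a b a≤c n)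

module _ {c a b : ℕ} (a≤c : a ≤ c) where

  private
    X Y : ℕ → ℕ
    X = count c a b
    Y = count c b a

    XY≡table : ∀ n → let s = table c a b n (n + c) in
               X (n + c) ≡ s × X (n + c) + Y (X (n + c)) ≡ s + table c b a n s
    XY≡table n = eX , trans (cong (λ s → s + Y s) eX)
                        (cong (table c a b n (n + c) +_) (count≡table c b a {n} (table-≤ c a b a≤c n)))
      where eX = count≡table c a b {n} ≤-refl

  count-move : ∀ {t} → c ≤ t → X t + Y (X t) ≤ suc t → X (suc t) ≡ suc (X t)
  count-move {t} c≤t = subst (λ t → X t + Y (X t) ≤ suc t → X (suc t) ≡ suc (X t)) (m∸n+n≡m c≤t) (move (t ∸ c))
    where
    move : ∀ n → X (n + c) + Y (X (n + c)) ≤ suc (n + c) → X (suc (n + c)) ≡ suc (X (n + c))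
    move n p = trans (count-next c a b n) (trans (if-≤ (subst (_≤ suc (n + c)) (proj₂ (XY≡table n)) p))
                 (cong suc (sym (proj₁ (XY≡table n)))))

  count-stay : ∀ {t} → c ≤ t → suc t < X t + Y (X t) → X (suc t) ≡ X t
  count-stay {t} c≤t = subst (λ t → suc t < X t + Y (X t) → X (suc t) ≡ X t) (m∸n+n≡m c≤t) (stay (t ∸ c))
    where
    stay : ∀ n → suc (n + c) < X (n + c) + Y (X (n + c)) → X (suc (n + c)) ≡ X (n + c)
    stay n p = trans (count-next c a b n) (trans (if-> (subst (suc (n + c) <_) (proj₂ (XY≡table n)) p))
                 (sym (proj₁ (XY≡table n))))

count-interlaced : ∀ a b → let c = suc (a + b) in
                   Interlaced c (suc a) (suc b) (count c (suc a) (suc b)) (count c (suc b) (suc a))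
count-interlaced a b = record
  { a≥1 = s≤s z≤n ; b≥1 = s≤s z≤n ; a+b = cong suc (+-suc a b)
  ; X-init = λ t≤c → count≡table (suc (a + b)) (suc a) (suc b) {0} t≤c
  ; Y-init = λ t≤c → count≡table (suc (a + b)) (suc b) (suc a) {0} t≤c
  ; X-move = count-move (s≤s (m≤m+n a b)) ; X-stay = count-stay (s≤s (m≤m+n a b))
  ; Y-move = count-move (s≤s (m≤n+m b a)) ; Y-stay = count-stay (s≤s (m≤n+m b a)) }

module _ {a b : ℕ} {X Y : ℕ → ℕ} (I : Interlaced (suc (a + b)) (suc a) (suc b) X Y) where

  private
    c = suc (a + b)

    Q : ℕ → ℕ → Set
    Q x y = Kernel c (suc a) (suc b) X Y (b + x) (a + y)

    b+a≡a+b : suc (b + a) ≡ c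
    b+a≡a+b = cong suc (+-comm b a)

    rect⇒ : ∀ {x y} → T (rect (suc a) (suc b) x y) → b + x < c × a + y < c
    rect⇒ {x} {y} t with Equivalence.to T-∧ t
    ... | p , q = subst (b + x <_) b+a≡a+b (s≤s (+-monoʳ-≤ b (≤-pred (<ᵇ⇒< x (suc a) p))))
                , s≤s (+-monoʳ-≤ a (≤-pred (<ᵇ⇒< y (suc b) q)))

    ⇒rect : ∀ {x y} → b + x < c × a + y < c → T (rect (suc a) (suc b) x y)
    ⇒rect {x} {y} (p , q) = Equivalence.from T-∧
      ( <⇒<ᵇ (s≤s (+-cancelˡ-≤ b x a (≤-pred (subst (b + x <_) (sym b+a≡a+b) p))))
      , <⇒<ᵇ (s≤s (+-cancelˡ-≤ a y b (≤-pred q))))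

    -- The kernel lies in the translated quadrant, so its points and the moves into it can be
    -- translated back.
    Kernel-≥ : ∀ {u v} → Kernel c (suc a) (suc b) X Y u v → b ≤ u × a ≤ v
    Kernel-≥ (corner p _ q _) = ≤-pred p , ≤-pred q
    Kernel-≥ (upper {u} up) = ≤-trans (m≤n+m b (suc a)) (rises⇒c≤ I up)
                            , ≤-trans (n≤1+n a) (≤-trans (a≤X I u) (m≤n+m (X u) u))
    Kernel-≥ (lower {v} dn) = ≤-trans (n≤1+n b) (≤-trans (a≤X (swap I) v) (m≤n+m (Y v) v))
                            , ≤-trans (≤-trans (m≤m+n a b) (n≤1+n _)) (rises⇒c≤ (swap I) dn)

    unshift : ∀ x y → Absorbs c (suc a) (suc b) X Y (b + x) (a + y) →
              Q x y ⊎ ∃₂ λ x′ y′ → Move x y x′ y′ × Q x′ y′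
    unshift x y (inj₁ q) = inj₁ q
    unshift x y (inj₂ (u , v , mv , K)) with m≤n⇒∃[o]m+o≡n (proj₁ (Kernel-≥ K)) | m≤n⇒∃[o]m+o≡n (proj₂ (Kernel-≥ K))
    ... | x′ , refl | y′ , refl = inj₂ (x′ , y′ , Move-unshift b a mv , K)

  Aset⇔ : ∀ {x y} → T (Aset (suc a) (suc b) x y) ⇔ Kernel c (suc a) (suc b) X Y (b + x) (a + y)
  Aset⇔ = isP⇔ {Q = Q}
    (λ {x} {y} t → let p , q = rect⇒ t in corner (s≤s (m≤m+n b x)) p (s≤s (m≤m+n a y)) q)
    (λ ¬t K mv → Kernel-stable I (λ p → ¬t (⇒rect p)) K (Move-shift b a mv))
    (λ x y → unshift x y (absorb I (s≤s (m≤m+n b x)) (s≤s (m≤m+n a y))))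

  shift-Aset⇔ : ∀ {u v} → T (shift b a (Aset (suc a) (suc b)) u v) ⇔ Kernel c (suc a) (suc b) X Y u v
  shift-Aset⇔ {u} {v} = mk⇔ to from
    where
    to : T (shift b a (Aset (suc a) (suc b)) u v) → Kernel c (suc a) (suc b) X Y u v
    to t with Equivalence.to T-∧ t
    ... | p , t′ with Equivalence.to T-∧ t′
    ...   | q , t″ = subst₂ (Kernel c (suc a) (suc b) X Y) (m+[n∸m]≡n (≤ᵇ⇒≤ b u p)) (m+[n∸m]≡n (≤ᵇ⇒≤ a v q))
                       (Equivalence.to Aset⇔ t″)
    from : Kernel c (suc a) (suc b) X Y u v → T (shift b a (Aset (suc a) (suc b)) u v)
    from K with Kernel-≥ K
    ... | p , q = Equivalence.from T-∧ (≤⇒≤ᵇ p , Equivalence.from T-∧ (≤⇒≤ᵇ q , Equivalence.from Aset⇔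
      (subst₂ (Kernel c (suc a) (suc b) X Y) (sym (m+[n∸m]≡n p)) (sym (m+[n∸m]≡n q)) K)))

-- For a = b = c = 1 the corner is the single point (0, 0). It is not forced here, so its stability
-- is checked separately: it has no moves.
Bset⇔ : ∀ {X} → Interlaced 1 1 1 X X → ∀ {x y} → T (Bset x y) ⇔ Kernel 1 1 1 X X x y
Bset⇔ {X} I = isP⇔ {Q = Kernel 1 1 1 X X} (λ ()) (λ _ → stable)
                (λ x y → absorb I (s≤s z≤n) (s≤s z≤n))
  where
  stable : ∀ {x y x′ y′} → Kernel 1 1 1 X X x y → Move x y x′ y′ → ¬ Kernel 1 1 1 X X x′ y′
  stable {x} {y} K mv with x <? 1 | y <? 1
  ... | no x≮1 | _       = Kernel-stable I (λ p → x≮1 (proj₁ p)) K mv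
  ... | yes _  | no y≮1  = Kernel-stable I (λ p → y≮1 (proj₂ p)) K mv
  ... | yes (s≤s z≤n) | yes (s≤s z≤n) = λ _ → terminal mv
    where
    terminal : ∀ {x′ y′} → ¬ Move 0 0 x′ y′
    terminal (horizontal ())
    terminal (vertical ())
    terminal (diagonal () _ _)

-- Counting the disagreements in a disc

∑-cong : ∀ {f g} n → (∀ i → f i ≡ g i) → ∑ f n ≡ ∑ g n
∑-cong zero    f≡g = refl
∑-cong (suc n) f≡g = cong₂ _+_ (∑-cong n f≡g) (f≡g n)

∑-suc-≤ : ∀ f n → ∑ (λ i → f (suc i)) n ≤ ∑ f (suc n)
∑-suc-≤ f zero    = z≤n
∑-suc-≤ f (suc n) = +-monoˡ-≤ (f (suc n)) (∑-suc-≤ f n)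

sum-upTo : ∀ f n → sum (map f (upTo n)) ≡ ∑ f n
sum-upTo f zero    = refl
sum-upTo f (suc n) = begin
  sum (map f (upTo (suc n)))               ≡⟨ cong (λ l → sum (map f l)) (upTo-∷ʳ n) ⟨
  sum (map f (upTo n ++ n ∷ []))           ≡⟨ cong sum (map-++ f (upTo n) (n ∷ [])) ⟩
  sum (map f (upTo n) ++ f n ∷ [])         ≡⟨ sum-++ (map f (upTo n)) (f n ∷ []) ⟩
  sum (map f (upTo n)) + (f n + 0)         ≡⟨ cong₂ _+_ (sum-upTo f n) (+-identityʳ (f n)) ⟩
  ∑ f n + f n                              ∎
  where open ≡-Reasoning

cell : PosSet → ℕ → ℕ → ℕ → ℕ
cell S n u v = 𝟙 ((u * u + v * v ≤ᵇ n * n) ∧ S u v)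

∑∑ : (ℕ → ℕ → ℕ) → ℕ → ℕ
∑∑ f n = ∑ (λ u → ∑ (f u) n) n

countDisc≡∑∑ : ∀ S n → countDisc S n ≡ ∑∑ (cell S n) (suc n)
countDisc≡∑∑ S n = trans (sum-upTo _ (suc n)) (∑-cong (suc n) (λ u → sum-upTo (cell S n u) (suc n)))

∑∑-mono : ∀ {f g} n → (∀ u v → f u v ≤ g u v) → ∑∑ f n ≤ ∑∑ g n
∑∑-mono n f≤g = ∑-mono n (λ {u} _ → ∑-mono n (λ {v} _ → f≤g u v))

∑∑-+ : ∀ f g n → ∑∑ (λ u v → f u v + g u v) n ≡ ∑∑ f n + ∑∑ g n
∑∑-+ f g n = trans (∑-cong n (λ u → ∑-+ (f u) (g u) n)) (∑-+ (λ u → ∑ (f u) n) (λ u → ∑ (g u) n) n)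

𝟙-<-∑ : ∀ c n → ∑ (λ i → 𝟙 (i <ᵇ c)) n ≤ c
𝟙-<-∑ c n = ≤-trans (∑-extend _ (m≤m⊔n n c)) (≤-reflexive
  (∑-initial _ c (n ⊔ c) 𝟙-≤ (λ c≤i → 𝟙-> (s≤s c≤i)) (m≤n⊔m n c)))

𝟙-≢ : ∀ {m n} → m ≢ n → 𝟙 (m ≡ᵇ n) ≡ 0
𝟙-≢ {m} {n} m≢n with m ≡ᵇ n in eq
... | false = refl
... | true  = ⊥-elim (m≢n (≡ᵇ⇒≡ m n (Equivalence.from T-≡ eq)))

𝟙-refl : ∀ n → 𝟙 (n ≡ᵇ n) ≡ 1
𝟙-refl n = cong 𝟙 (Equivalence.to T-≡ (≡⇒≡ᵇ n n refl))

∑-𝟙-≡ : ∀ k n → ∑ (λ i → 𝟙 (i ≡ᵇ k)) n ≤ 1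
∑-𝟙-≡ k zero = z≤n
∑-𝟙-≡ k (suc n) with n ≟ k
... | no n≢k   = ≤-trans (≤-reflexive (trans (cong (∑ _ n +_) (𝟙-≢ n≢k)) (+-identityʳ _))) (∑-𝟙-≡ k n)
... | yes refl = ≤-reflexive (cong₂ _+_ (before n ≤-refl) (𝟙-refl n))
  where
  before : ∀ m → m ≤ n → ∑ (λ i → 𝟙 (i ≡ᵇ n)) m ≡ 0
  before zero    _   = refl
  before (suc m) m<n = cong₂ _+_ (before m (<⇒≤ m<n)) (𝟙-≢ (<⇒≢ m<n))

∑-*-𝟙-≤ : ∀ k (g : ℕ → Bool) n → (∑ (λ i → 𝟙 (g i)) n ≤ 1) → ∑ (λ i → k * 𝟙 (g i)) n ≤ k
∑-*-𝟙-≤ k g n ≤1 = begin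
  ∑ (λ i → k * 𝟙 (g i)) n  ≡⟨ ∑-*ˡ k (λ i → 𝟙 (g i)) n ⟩
  k * ∑ (λ i → 𝟙 (g i)) n  ≤⟨ *-monoʳ-≤ k ≤1 ⟩
  k * 1                    ≡⟨ *-identityʳ k ⟩
  k                        ∎
  where open ≤-Reasoning

suc-*-≥1 : ∀ k {x} → x ≡ 1 → 1 ≤ suc k * x
suc-*-≥1 k refl = s≤s z≤n

module _ {c a b X Y c′ a′ b′ X′ Y′} (I : Interlaced c a b X Y) (I′ : Interlaced c′ a′ b′ X′ Y′) where

  private
    -- Whether column u has an upper position, and where, depends only on X u and X (u + 1); a
    -- disagreement at either is charged to u.
    weight : (ℕ → ℕ) → (ℕ → ℕ) → ℕ → ℕ
    weight X X′ u = ∣ X u - X′ u ∣ + ∣ X (suc u) - X′ (suc u) ∣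

    weight-∑ : ∀ X X′ n → ∑ (weight X X′) n ≤ 2 * ∑ (λ u → ∣ X u - X′ u ∣) (suc n)
    weight-∑ X X′ n = begin
      ∑ (weight X X′) n                          ≡⟨ ∑-+ d (λ u → d (suc u)) n ⟩
      ∑ d n + ∑ (λ u → d (suc u)) n              ≤⟨ +-mono-≤ (m≤m+n (∑ d n) (d n)) (∑-suc-≤ d n) ⟩
      ∑ d (suc n) + ∑ d (suc n)                  ≡⟨ cong (∑ d (suc n) +_) (sym (+-identityʳ _)) ⟩
      2 * ∑ d (suc n)                            ∎
      where
      open ≤-Reasoning
      d : ℕ → ℕ
      d u = ∣ X u - X′ u ∣

    rises-transfer : ∀ X X′ u → X (suc u) ≡ suc (X u) → weight X X′ u ≡ 0 →
                     X′ (suc u) ≡ suc (X′ u) × X′ u ≡ X u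
    rises-transfer X X′ u up w = trans (sym eq₁) (trans up (cong suc eq₀)) , sym eq₀
      where
      eq₀ = ∣m-n∣≡0⇒m≡n (m+n≡0⇒m≡0 ∣ X u - X′ u ∣ w)
      eq₁ = ∣m-n∣≡0⇒m≡n (m+n≡0⇒n≡0 ∣ X u - X′ u ∣ w)

  -- A bound for the indicator of the first kernel minus the second: a full charge on the square
  -- containing the corner, and the weights placed along the two graphs.
  surplus : ℕ → ℕ → ℕ
  surplus u v = 𝟙 (u <ᵇ c) * 𝟙 (v <ᵇ c)
              + (weight X X′ u * 𝟙 (v ≡ᵇ u + X u) + weight Y Y′ v * 𝟙 (u ≡ᵇ v + Y v))

  surplus-≥1 : ∀ {u v} → Kernel c a b X Y u v → ¬ Kernel c′ a′ b′ X′ Y′ u v → 1 ≤ surplus u v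
  surplus-≥1 {u} {v} (corner _ u<c _ v<c) ¬K = ≤-trans (≤-reflexive (sym (cong₂ _*_ (𝟙-≤ u<c) (𝟙-≤ v<c)))) (m≤m+n _ _)
  surplus-≥1 (upper {u} up) ¬K with weight X X′ u in w
  ... | zero with rises-transfer X X′ u up w
  ...   | up′ , e = ⊥-elim (¬K (subst (λ x → Kernel c′ a′ b′ X′ Y′ u (u + x)) e (upper up′)))
  surplus-≥1 (upper {u} up) ¬K | suc k = ≤-trans (suc-*-≥1 k (𝟙-refl (u + X u)))
    (≤-trans (m≤m+n (suc k * 𝟙 (u + X u ≡ᵇ u + X u)) _) (m≤n+m _ (𝟙 (u <ᵇ c) * 𝟙 (u + X u <ᵇ c))))
  surplus-≥1 (lower {v} dn) ¬K with weight Y Y′ v in w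
  ... | zero with rises-transfer Y Y′ v dn w
  ...   | dn′ , e = ⊥-elim (¬K (subst (λ y → Kernel c′ a′ b′ X′ Y′ (v + y) v) e (lower dn′)))
  surplus-≥1 (lower {v} dn) ¬K | suc k = ≤-trans (suc-*-≥1 k (𝟙-refl (v + Y v)))
    (≤-trans (m≤n+m (suc k * 𝟙 (v + Y v ≡ᵇ v + Y v)) (weight X X′ (v + Y v) * 𝟙 (v ≡ᵇ v + Y v + X (v + Y v))))
             (m≤n+m _ (𝟙 (v + Y v <ᵇ c) * 𝟙 (v <ᵇ c))))

  -- Each column and each row carries its weight in at most one cell, and each distance enters at
  -- most two weights.
  surplus-∑∑ : ∀ n → ∑∑ surplus n ≤ c * c + 2 * discrepancy I I′ (suc n)
  surplus-∑∑ n = begin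
    ∑∑ surplus n                                   ≡⟨ ∑∑-+ s₀ (λ u v → s₁ u v + s₂ u v) n ⟩
    ∑∑ s₀ n + ∑∑ (λ u v → s₁ u v + s₂ u v) n       ≡⟨ cong (∑∑ s₀ n +_) (∑∑-+ s₁ s₂ n) ⟩
    ∑∑ s₀ n + (∑∑ s₁ n + ∑∑ s₂ n)                  ≤⟨ +-mono-≤ ∑∑s₀ (+-mono-≤ ∑∑s₁ ∑∑s₂) ⟩
    c * c + (2 * dX + 2 * dY)                      ≡⟨ cong (c * c +_) (*-distribˡ-+ 2 dX dY) ⟨
    c * c + 2 * discrepancy I I′ (suc n)           ∎
    where
    open ≤-Reasoning
    dX = ∑ (λ u → ∣ X u - X′ u ∣) (suc n)
    dY = ∑ (λ u → ∣ Y u - Y′ u ∣) (suc n)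
    s₀ s₁ s₂ : ℕ → ℕ → ℕ
    s₀ u v = 𝟙 (u <ᵇ c) * 𝟙 (v <ᵇ c)
    s₁ u v = weight X X′ u * 𝟙 (v ≡ᵇ u + X u)
    s₂ u v = weight Y Y′ v * 𝟙 (u ≡ᵇ v + Y v)
    ∑∑s₀ : ∑∑ s₀ n ≤ c * c
    ∑∑s₀ = begin
      ∑∑ s₀ n                         ≤⟨ ∑-mono n (λ {u} _ → ≤-trans (≤-reflexive (∑-*ˡ (𝟙 (u <ᵇ c)) (λ v → 𝟙 (v <ᵇ c)) n)) (≤-trans (*-monoʳ-≤ (𝟙 (u <ᵇ c)) (𝟙-<-∑ c n)) (≤-reflexive (*-comm _ c)))) ⟩
      ∑ (λ u → c * 𝟙 (u <ᵇ c)) n      ≡⟨ ∑-*ˡ c (λ u → 𝟙 (u <ᵇ c)) n ⟩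
      c * ∑ (λ u → 𝟙 (u <ᵇ c)) n      ≤⟨ *-monoʳ-≤ c (𝟙-<-∑ c n) ⟩
      c * c                           ∎
    ∑∑s₁ : ∑∑ s₁ n ≤ 2 * dX
    ∑∑s₁ = ≤-trans (∑-mono n (λ {u} _ → ∑-*-𝟙-≤ (weight X X′ u) (λ v → v ≡ᵇ u + X u) n (∑-𝟙-≡ (u + X u) n)))
                   (weight-∑ X X′ n)
    ∑∑s₂ : ∑∑ s₂ n ≤ 2 * dY
    ∑∑s₂ = ≤-trans (≤-reflexive (∑-swap s₂ n n))
           (≤-trans (∑-mono n (λ {v} _ → ∑-*-𝟙-≤ (weight Y Y′ v) (λ u → u ≡ᵇ v + Y v) n (∑-𝟙-≡ (v + Y v) n)))
                    (weight-∑ Y Y′ n))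

∪-≤-∩ : ∀ d s t {e} → (T s → ¬ T t → 1 ≤ e) → (T t → ¬ T s → 1 ≤ e) → 𝟙 (d ∧ (s ∨ t)) ≤ 𝟙 (d ∧ (s ∧ t)) + e
∪-≤-∩ false _     _     _ _ = z≤n
∪-≤-∩ true  false false _ _ = z≤n
∪-≤-∩ true  true  true  _ _ = s≤s z≤n
∪-≤-∩ true  true  false p _ = p tt (λ ())
∪-≤-∩ true  false true  _ q = q tt (λ ())

∩-≤-∪ : ∀ d s t → 𝟙 (d ∧ (s ∧ t)) ≤ 𝟙 (d ∧ (s ∨ t))
∩-≤-∪ false _     _     = z≤n
∩-≤-∪ true  false _     = z≤n
∩-≤-∪ true  true  false = z≤n
∩-≤-∪ true  true  true  = ≤-refl

countDisc-∩-≤-∪ : ∀ S S′ n → countDisc (S ∩ₛ S′) n ≤ countDisc (S ∪ₛ S′) n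
countDisc-∩-≤-∪ S S′ n = begin
  countDisc (S ∩ₛ S′) n          ≡⟨ countDisc≡∑∑ (S ∩ₛ S′) n ⟩
  ∑∑ (cell (S ∩ₛ S′) n) (suc n)  ≤⟨ ∑∑-mono (suc n) (λ u v → ∩-≤-∪ _ (S u v) (S′ u v)) ⟩
  ∑∑ (cell (S ∪ₛ S′) n) (suc n)  ≡⟨ countDisc≡∑∑ (S ∪ₛ S′) n ⟨
  countDisc (S ∪ₛ S′) n          ∎
  where open ≤-Reasoning

module _ {c a b X Y c′ a′ b′ X′ Y′} (I : Interlaced c a b X Y) (I′ : Interlaced c′ a′ b′ X′ Y′) {S S′ : PosSet}
         (S⇔ : ∀ {u v} → T (S u v) ⇔ Kernel c a b X Y u v)
         (S′⇔ : ∀ {u v} → T (S′ u v) ⇔ Kernel c′ a′ b′ X′ Y′ u v) where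

  countDisc-∪-≤-∩ : ∀ n → countDisc (S ∪ₛ S′) n ≤ countDisc (S ∩ₛ S′) n
    + (c * c + c′ * c′ + 2 * (discrepancy I I′ (2 + n) + discrepancy I′ I (2 + n)))
  countDisc-∪-≤-∩ n = begin
    countDisc (S ∪ₛ S′) n          ≡⟨ countDisc≡∑∑ (S ∪ₛ S′) n ⟩
    ∑∑ (cell (S ∪ₛ S′) n) (suc n)  ≤⟨ ∑∑-mono (suc n) pointwise ⟩
    ∑∑ (λ u v → cell (S ∩ₛ S′) n u v + (surplus I I′ u v + surplus I′ I u v)) (suc n)
      ≡⟨ ∑∑-+ (cell (S ∩ₛ S′) n) _ (suc n) ⟩
    ∑∑ (cell (S ∩ₛ S′) n) (suc n) + ∑∑ (λ u v → surplus I I′ u v + surplus I′ I u v) (suc n)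
      ≡⟨ cong₂ _+_ (sym (countDisc≡∑∑ (S ∩ₛ S′) n)) (∑∑-+ (surplus I I′) (surplus I′ I) (suc n)) ⟩
    countDisc (S ∩ₛ S′) n + (∑∑ (surplus I I′) (suc n) + ∑∑ (surplus I′ I) (suc n))
      ≤⟨ +-monoʳ-≤ (countDisc (S ∩ₛ S′) n) (+-mono-≤ (surplus-∑∑ I I′ (suc n)) (surplus-∑∑ I′ I (suc n))) ⟩
    countDisc (S ∩ₛ S′) n + (c * c + 2 * discrepancy I I′ (2 + n) + (c′ * c′ + 2 * discrepancy I′ I (2 + n)))
      ≡⟨ cong (countDisc (S ∩ₛ S′) n +_) (lemma (c * c) (discrepancy I I′ (2 + n)) (c′ * c′) (discrepancy I′ I (2 + n))) ⟩
    countDisc (S ∩ₛ S′) n + (c * c + c′ * c′ + 2 * (discrepancy I I′ (2 + n) + discrepancy I′ I (2 + n))) ∎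
    where
    open ≤-Reasoning
    lemma : ∀ p q r s → p + 2 * q + (r + 2 * s) ≡ p + r + 2 * (q + s)
    lemma = solve-∀
    pointwise : ∀ u v → cell (S ∪ₛ S′) n u v ≤ cell (S ∩ₛ S′) n u v + (surplus I I′ u v + surplus I′ I u v)
    pointwise u v = ∪-≤-∩ _ (S u v) (S′ u v)
      (λ s ¬s′ → ≤-trans (surplus-≥1 I I′ (Equivalence.to S⇔ s) (λ K → ¬s′ (Equivalence.from S′⇔ K))) (m≤m+n (surplus I I′ u v) _))
      (λ s′ ¬s → ≤-trans (surplus-≥1 I′ I (Equivalence.to S′⇔ s′) (λ K → ¬s (Equivalence.from S⇔ K))) (m≤n+m _ (surplus I I′ u v)))

module _ {X} (I : Interlaced 1 1 1 X X) {S S′ : PosSet} (S′⇔ : ∀ {u v} → T (S′ u v) ⇔ Kernel 1 1 1 X X u v) where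

  private
    row : ℕ → ℕ → ℕ
    row n u = ∑ (cell (S ∪ₛ S′) n u) (suc n)

    -- Since X u ≤ u + 1, the coordinates of the upper position in column u add up to at most 3 * u
    -- + 1 ≤ n, and the sum of squares is at most the square of the sum.
    row-≥1 : ∀ n u → suc (3 * u) ≤ n → X (suc u) ≡ suc (X u) → 1 ≤ row n u
    row-≥1 n u 3u<n up = ≤-trans (≤-reflexive (sym (cong 𝟙 (Equivalence.to T-≡ (Equivalence.from T-∧ (≤⇒≤ᵇ in-disc , in-set))))))
                           (∑-term (cell (S ∪ₛ S′) n u) (s≤s (≤-trans (m≤n+m v u) u+v≤n)))
      where
      v = u + X u
      lemma₁ : ∀ u → u + (u + (u + 1)) ≡ suc (3 * u)
      lemma₁ = solve-∀
      lemma₂ : ∀ u v → u * u + v * v + 2 * (u * v) ≡ (u + v) * (u + v)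
      lemma₂ = solve-∀
      u+v≤n : u + v ≤ n
      u+v≤n = ≤-trans (+-monoʳ-≤ u (+-monoʳ-≤ u (X-≤-a+ I u))) (≤-trans (≤-reflexive (lemma₁ u)) 3u<n)
      in-disc : u * u + v * v ≤ n * n
      in-disc = ≤-trans (m≤m+n _ (2 * (u * v))) (≤-trans (≤-reflexive (lemma₂ u v)) (*-mono-≤ u+v≤n u+v≤n))
      in-set : T (S u v ∨ S′ u v)
      in-set = Equivalence.from T-∨ (inj₂ (Equivalence.from S′⇔ (upper up)))

    -- Each rise of `X` before m supplies a position in its own column; the 1 is the initial value
    -- of `X`.
    X-≤-rows : ∀ n m → 3 * m ≤ n → X m ≤ 1 + ∑ (row n) m
    X-≤-rows n zero    _    = ≤-reflexive (X-init I z≤n)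
    X-≤-rows n (suc m) 3m<n = ≤-trans (X-≤-row (X-step I m)) (+-monoˡ-≤ (row n m) (X-≤-rows n m 3m≤n))
      where
      3m+1≤n : suc (3 * m) ≤ n
      3m+1≤n = ≤-trans (≤-trans (≤-reflexive (+-comm 1 (3 * m))) (≤-trans (+-monoʳ-≤ (3 * m) (s≤s z≤n)) (≤-reflexive (trans (+-comm (3 * m) 3) (sym (*-suc 3 m)))))) 3m<n
      3m≤n : 3 * m ≤ n
      3m≤n = <⇒≤ 3m+1≤n
      X-≤-row : X (suc m) ≡ X m ⊎ X (suc m) ≡ suc (X m) → X (suc m) ≤ X m + row n m
      X-≤-row (inj₁ e)  = ≤-trans (≤-reflexive e) (m≤m+n _ _)
      X-≤-row (inj₂ up) = ≤-trans (≤-reflexive (trans up (+-comm 1 (X m)))) (+-monoʳ-≤ (X m) (row-≥1 n m 3m+1≤n up))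

  -- Only upper positions in the columns below n / 3 are counted. There `X` has slope at least one
  -- half, whence the factor 6.
  countDisc-∪-≥ : ∀ n → n ≤ 6 * countDisc (S ∪ₛ S′) n + 12
  countDisc-∪-≥ n = from-≤ 1 (+-mono-≤ n≤ (+-mono-≤ (*-monoʳ-≤ 3 (<-2X I m)) (*-monoʳ-≤ 6 X≤)))
                      (lemma n m (X m) (countDisc (S ∪ₛ S′) n))
    where
    m = n / 3
    lemma : ∀ n m x k → n + (2 + 3 * m + (3 * (2 * x + 2) + 6 * (1 + k))) + 1 ≡ 6 * k + 12 + (n + (3 * suc m + 6 * x))
    lemma = solve-∀
    n≡ : n ≡ n % 3 + m * 3
    n≡ = m≡m%n+[m/n]*n n 3
    n≤ : n ≤ 2 + 3 * m
    n≤ = ≤-trans (≤-reflexive n≡) (+-mono-≤ (≤-pred (m%n<n n 3)) (≤-reflexive (*-comm m 3)))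
    3m≤n : 3 * m ≤ n
    3m≤n = ≤-trans (≤-reflexive (*-comm 3 m)) (≤-trans (m≤n+m (m * 3) (n % 3)) (≤-reflexive (sym n≡)))
    X≤ : X m ≤ 1 + countDisc (S ∪ₛ S′) n
    X≤ = ≤-trans (X-≤-rows n m 3m≤n) (s≤s (≤-trans (∑-extend (row n) (m≤n⇒m≤1+n (≤-trans (m≤n*m m 3) 3m≤n)))
           (≤-reflexive (sym (countDisc≡∑∑ (S ∪ₛ S′) n)))))

-- Ratios

-- The distance of i / (m + 1) from 1 is (m + 1 - i) / (m + 1), and a positive rational is at least
-- the reciprocal of its denominator.
near-one : ∀ {i m} ε → 0ℚ ℚ.< ε → i ≤ suc m → ℚ.↧ₙ ε * (suc m ∸ i) < suc m →
           ℚ.∣ (ℤ.+ i) ℚ./ suc m ℚ.- 1ℚ ∣ ℚ.< ε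
near-one (mkℚ (ℤ.+ 0) _ _)     (*<* (+<+ ())) _ _
near-one (mkℚ -[1+ _ ] _ _)  (*<* ()) _ _
near-one {i} {m} (mkℚ +[1+ p ] d _) _ i≤m small = ℚ.toℚᵘ-cancel-< (ℚᵘ.<-respˡ-≃ (ℚᵘ.≃-sym unnormalised) close)
  where
  x = (ℤ.+ i) ℚ./ suc m
  unnormalised : toℚᵘ ℚ.∣ x ℚ.- 1ℚ ∣ ℚᵘ.≃ ℚᵘ.∣ mkℚᵘ (ℤ.+ i) m ℚᵘ.- 1ℚᵘ ∣
  unnormalised = ℚᵘ.≃-trans (ℚ.toℚᵘ-homo-∣-∣ (x ℚ.- 1ℚ)) (ℚᵘ.∣-∣-cong
    (ℚᵘ.≃-trans (ℚ.toℚᵘ-homo-+ x (ℚ.- 1ℚ)) (ℚᵘ.+-congˡ (ℚᵘ.- 1ℚᵘ) (ℚ.toℚᵘ-fromℚᵘ (mkℚᵘ (ℤ.+ i) m)))))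
  numerator : ℤ.∣ ℤ.+ i ℤ.* ℤ.+ 1 ℤ.+ -[1+ 0 ] ℤ.* ℤ.+ suc m ∣ ≡ suc m ∸ i
  numerator = trans (cong ℤ.∣_∣ (trans (cong₂ ℤ._+_ (ℤ.*-identityʳ (ℤ.+ i)) (ℤ.-1*i≡-i (ℤ.+ suc m))) (ℤ.m-n≡m⊖n i (suc m))))
                    (ℤ.∣⊖∣-≤ i≤m)
  close : ℚᵘ.∣ mkℚᵘ (ℤ.+ i) m ℚᵘ.- 1ℚᵘ ∣ ℚᵘ.< mkℚᵘ +[1+ p ] d
  close = ℚᵘ.*<* (subst₂ ℤ._<_ (trans (cong ℤ.+_ (*-comm (suc d) (suc m ∸ i))) (trans (ℤ.pos-* (suc m ∸ i) (suc d)) (cong (λ n → ℤ.+ n ℤ.* ℤ.+ suc d) (sym numerator))))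
    (ℤ.pos-* (suc p) (suc m * 1))
    (+<+ (<-≤-trans small (≤-trans (≤-reflexive (sym (*-identityʳ (suc m)))) (m≤n*m (suc m * 1) (suc p))))))

ratio-near-one : ∀ S S′ n {e} ε → 0ℚ ℚ.< ε → countDisc (S ∪ₛ S′) n ≤ countDisc (S ∩ₛ S′) n + e →
                 ℚ.↧ₙ ε * e < countDisc (S ∪ₛ S′) n →
                 ℚ.∣ ratio S S′ n ℚ.- 1ℚ ∣ ℚ.< ε
ratio-near-one S S′ n ε ε>0 ∪≤ small with countDisc (S ∪ₛ S′) n | countDisc-∩-≤-∪ S S′ n
-- An empty union contradicts the strict hypothesis, so the count is a successor.
... | suc m | ∩≤ = near-one ε ε>0 ∩≤ (≤-<-trans (*-monoʳ-≤ (ℚ.↧ₙ ε) (m≤n+o⇒m∸n≤o (suc m) _ ∪≤)) small)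

Kernels-asymptoticallyEqual : ∀ {c a b X Y Z} → Interlaced c a b X Y → Interlaced 1 1 1 Z Z → {S S′ : PosSet} →
  (∀ {u v} → T (S u v) ⇔ Kernel c a b X Y u v) → (∀ {u v} → T (S′ u v) ⇔ Kernel 1 1 1 Z Z u v) →
  AsymptoticallyEqual S S′
Kernels-asymptoticallyEqual {c} I I′ {S} {S′} S⇔ S′⇔ ε ε>0
  -- The factor 28 makes each of the two terms 2 * q * δ at most about n / 14. Together they stay
  -- near n / 7, below the n / 6 guaranteed for the union.
  with discrepancy-sublinear I I′ (28 * ℚ.↧ₙ ε) | discrepancy-sublinear I′ I (28 * ℚ.↧ₙ ε)
... | K , bound | K′ , bound′ = N , λ n N≤n → ratio-near-one S S′ n ε ε>0 (countDisc-∪-≤-∩ I I′ S⇔ S′⇔ n) (small n N≤n)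
  where
  q = ℚ.↧ₙ ε
  -- The 1 is the square of the side of the corner of the unaltered game.
  s = c * c + 1
  -- After multiplication by 42 the errors use 6 * n of the available 7 * n. The remaining n must
  -- exceed the constants, where 96 = 12 + 84 comes from the shift to 2 + n and from the 12 in
  -- `countDisc-∪-≥`.
  N = 42 * (q * s) + 3 * (K + K′) + 97
  small : ∀ n → N ≤ n → q * (s + 2 * (discrepancy I I′ (2 + n) + discrepancy I′ I (2 + n))) < countDisc (S ∪ₛ S′) n
  small n N≤n = *-cancelˡ-< 42 _ _ (from-≤ 0
    (+-mono-≤ (+-mono-≤ (*-monoʳ-≤ 3 (bound (2 + n))) (*-monoʳ-≤ 3 (bound′ (2 + n))))
      (+-mono-≤ (*-monoʳ-≤ 7 (countDisc-∪-≥ I′ {S} S′⇔ n)) N≤n))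
    (lemma q s (discrepancy I I′ (2 + n)) (discrepancy I′ I (2 + n)) n K K′ (countDisc (S ∪ₛ S′) n)))
    where
    lemma : ∀ q s δ δ′ n K K′ u →
      suc (42 * (q * (s + 2 * (δ + δ′)))) + (3 * (2 + n + K) + 3 * (2 + n + K′) + (7 * (6 * u + 12) + n)) + 0
      ≡ 42 * u + (3 * (28 * q * δ) + 3 * (28 * q * δ′) + (7 * n + (42 * (q * s) + 3 * (K + K′) + 97)))
    lemma = solve-∀

theorem2 : (a b : ℕ) → a ≥ 1 → b ≥ 1 →
    AsymptoticallyEqual (shift (b ∸ 1) (a ∸ 1) (Aset a b)) Bset
theorem2 (suc a) (suc b) _ _ = Kernels-asymptoticallyEqual I I₁ {shift b a (Aset (suc a) (suc b))} {Bset} (shift-Aset⇔ I) (Bset⇔ I₁)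
  where
  I  = count-interlaced a b
  I₁ = count-interlaced 0 0
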